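{- Let $n \ge 2$, $m$, $\delta$ be integers with $\delta \geq n$ and $m \leq 3\delta - 5$. Let $G$ be a bipartite graph with bipartition $(X,Y)$, $|X|=n$, $|Y|=m$, and every $x\in X$ of degree at least $\delta$. Suppose that for each $A \subseteq X$ with $|A| \geq 3$ there is $B \subseteq Y$ with $|B| \geq |A|$ such that the induced subgraph $G[A \cup B]$ is 2-connected. Then $G$ is $X$-super-pancyclic, i.e., for every $X' \subseteq X$ with $|X'| \geq 3$, $G$ has a cycle $C$ with $V(C) \cap X = X'$. -}

module Defs where

open import Level using (0ℓ)
open import Data.Empty using (⊥)
open import Data.Fin using (Fin)
open import Data.Fin.Subset using (Subset; ∣_∣)
import Data.Fin.Subset as Subset
open import Data.List using (List; _∷_; _∷ʳ_; length)
open import Data.List.Membership.Propositional using (_∈_)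
open import Data.List.Relation.Unary.Linked using (Linked)
open import Data.List.Relation.Unary.Unique.Propositional using (Unique)
open import Data.Nat using (ℕ; _≤_)
open import Data.Product using (_×_; _,_; ∃-syntax)
open import Data.Sum using (_⊎_; inj₁; inj₂)
open import Data.Unit using (tt)
open import Data.Vec using (tabulate)
open import Function using (_⇔_)
open import Function.Definitions using (Injective)
open import Relation.Binary using (Rel; REL; Symmetric; Decidable)
open import Relation.Binary.Construct.Closure.ReflexiveTransitive using (Star)
open import Relation.Binary.PropositionalEquality using (_≡_)
open import Relation.Nullary using (¬_; does)
open import Relation.Unary using (Pred; U; ∁; ｛_｝; _∩_; _⟨⊎⟩_; Satisfiable)

-- The vertex set is a predicate on an ambient type A, rather than a type of
-- its own, so that induced subgraphs do not carry membership proofs in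
-- their vertices.
record Graph (A : Set) : Set₁ where
  infix 4 _~_
  field
    V        : Pred A 0ℓ
    _~_      : Rel A 0ℓ
    ~-sym    : Symmetric _~_
    ~-irrefl : ∀ {u} → ¬ (u ~ u)
    ~-inV    : ∀ {u v} → u ~ v → V u

module _ {A : Set} where

  open Graph

  infix 9 _[_]
  _[_] : Graph A → Pred A 0ℓ → Graph A
  (G [ S ]) .V                      = V G ∩ S
  (G [ S ]) ._~_ u v                = Graph._~_ G u v × S u × S v
  (G [ S ]) .~-sym (e , su , sv)    = ~-sym G e , sv , su
  (G [ S ]) .~-irrefl (e , _)       = ~-irrefl G e
  (G [ S ]) .~-inV (e , su , _)     = ~-inV G e , su

  _-ᵥ_ : Graph A → A → Graph A
  G -ᵥ v = G [ ∁ ｛ v ｝ ]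

  Connected : Graph A → Set
  Connected G = Satisfiable (V G)
              × (∀ {u v} → V G u → V G v → Star (Graph._~_ G) u v)

  AtLeast : ℕ → Pred A 0ℓ → Set
  AtLeast k S = ∃[ f ] Injective {A = Fin k} _≡_ _≡_ f × (∀ i → S (f i))

  2-Connected : Graph A → Set
  2-Connected G = AtLeast 3 (V G)
                × Connected G
                × (∀ v → V G v → Connected (G -ᵥ v))

  record Cycle (G : Graph A) : Set where
    field
      start : A
      rest  : List A

    vertices : List A
    vertices = start ∷ rest

    field
      long     : 3 ≤ length vertices
      distinct : Unique vertices
      closed   : Linked (Graph._~_ G) (vertices ∷ʳ start)

-- Bipartite graphs with parts X = Fin n and Y = Fin m.
record Bigraph (n m : ℕ) : Set₁ where
  infix 4 _—_ _—?_
  field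
    _—_  : REL (Fin n) (Fin m) 0ℓ
    _—?_ : Decidable _—_

  Vertex : Set
  Vertex = Fin n ⊎ Fin m

  neighbours : Fin n → Subset m
  neighbours x = tabulate (λ y → does (x —? y))

  degree : Fin n → ℕ
  degree x = ∣ neighbours x ∣

  Adjacent : Rel Vertex 0ℓ
  Adjacent (inj₁ x) (inj₂ y) = x — y
  Adjacent (inj₂ y) (inj₁ x) = x — y
  Adjacent (inj₁ _) (inj₁ _) = ⊥
  Adjacent (inj₂ _) (inj₂ _) = ⊥

  graph : Graph Vertex
  graph = record
    { V        = U
    ; _~_      = Adjacent
    ; ~-sym    = λ {u} {v} → symmetric u v
    ; ~-irrefl = λ {u} → irreflexive u
    ; ~-inV    = λ _ → tt
    }
    where
    symmetric : ∀ u v → Adjacent u v → Adjacent v u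
    symmetric (inj₁ _) (inj₂ _) e = e
    symmetric (inj₂ _) (inj₁ _) e = e

    irreflexive : ∀ u → ¬ Adjacent u u
    irreflexive (inj₁ _) ()
    irreflexive (inj₂ _) ()

  _⊔ᵥ_ : Subset n → Subset m → Pred Vertex 0ℓ
  A ⊔ᵥ B = (Subset._∈ A) ⟨⊎⟩ (Subset._∈ B)

  -- V(C) ∩ X = X′, as extensional equality of sets.
  MeetsXIn : Cycle graph → Subset n → Set
  MeetsXIn C X′ = ∀ x → inj₁ x ∈ Cycle.vertices C ⇔ x Subset.∈ X′

  X-SuperPancyclic : Set
  X-SuperPancyclic =
    ∀ (X′ : Subset n) → 3 ≤ ∣ X′ ∣ → ∃[ C ] MeetsXIn C X′

{-# OPTIONS --safe #-}

-- Induct on X′ = L, with |L| = k + 1, and suppose that no cycle meets X in L. Then the ends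
-- of a path through all of L whose Y-part is S have no common neighbour outside S; call such
-- vertices apart. Pairwise apart vertices v₁, …, v_r satisfy the packing inequality
--   r δ + |S| ≤ m + Σ deg_S vᵢ,
-- which for r ≥ 3 is strong because m ≤ 3δ − 5 and δ ≥ k + 1.
--
-- By induction (or a 4-cycle when |L| = 3) some x ∈ L has a cycle through L − x, with Y-part S,
-- |S| = k. Take x and the cycle with d = deg_S x maximal. The vertex x and the d cycle
-- successors of its neighbours are pairwise apart. The ends a, z of a path through L are also
-- apart from its pivots, the vertices w whose predecessor is adjacent to z and whose successor
-- is adjacent to a; leaving out a pivot gives a cycle with Y-part S, so pivots have degree at
-- most d in S, and deg_S a + deg_S z ≤ #pivots + k + 1.
--
-- If 2 ≤ d ≤ k − 2, packing the successors makes their degrees large, while packing the pivots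
-- makes the degree sum of any two successors small. If d ≥ max(2, k − 1), a vertex b ∉ S with
-- two neighbours in L must be joined to the two ends of one fixed link of the cycle, so b can
-- replace the Y-vertex y₀ of that link, y₀ has the same two neighbours in L, and packing fails.
-- If d ≤ 1 there are no pivots; 2-connectivity gives two ways out of x to the cycle, and
-- packing x with the ends of the path that uses both fails.

module Submission where

open import Defs
open import Algebra.Bundles using (CommutativeMonoid)
import Algebra.Construct.DirectProduct as DirectProduct
import Algebra.Solver.CommutativeMonoid as CommutativeMonoidSolver
open import Data.Bool using (true; false)
open import Data.Empty using (⊥; ⊥-elim)
open import Data.Fin using (Fin)
import Data.Fin as Fin
import Data.Fin.Properties as Fin
open import Data.Fin.Subset using (Subset; ∣_∣)
import Data.Fin.Subset as Subset
import Data.Fin.Subset.Properties as Subset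
open import Data.List using (List; []; _∷_; _++_; _∷ʳ_; length; map; concat; filter; allFin)
import Data.List as List
open import Data.List.Properties
  using (length-++; length-tabulate; length-filter; length-map; filter-all; filter-none; filter-accept; filter-reject)
open import Data.List.Membership.Propositional using (_∈_; _∉_; find)
open import Data.List.Membership.Propositional.Properties
  using (∈-∃++; ∈-++⁺ˡ; ∈-++⁺ʳ; ∈-++⁻; ∈-filter⁺; ∈-filter⁻; ∈-allFin)
open import Data.List.Relation.Binary.Disjoint.Propositional using (Disjoint)
open import Data.List.Relation.Binary.Permutation.Propositional
  using (_↭_; ↭-refl; ↭-sym; ↭-trans; ↭⇒↭ₛ; prep)
open import Data.List.Relation.Binary.Permutation.Propositional.Properties
  using (++-commutativeMonoid; ↭-length; filter-↭; ∈-resp-↭; shift)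
import Data.List.Relation.Binary.Permutation.Setoid.Properties as Permutationₛ
open import Data.List.Relation.Binary.Subset.Propositional using (_⊆_)
open import Data.List.Relation.Unary.All as All using (All; []; _∷_)
import Data.List.Relation.Unary.All.Properties as All
open import Data.List.Relation.Unary.AllPairs as AllPairs using (AllPairs; []; _∷_)
import Data.List.Relation.Unary.AllPairs.Properties as AllPairs
open import Data.List.Relation.Unary.Any using (here; there)
open import Data.List.Relation.Unary.Linked using (Linked; []; [-]; _∷_; linked?)
open import Data.List.Relation.Unary.Unique.Propositional using (Unique)
open import Data.List.Relation.Unary.Unique.DecPropositional using (unique?)
import Data.List.Relation.Unary.Unique.Propositional.Properties as Unique
open import Data.Nat using (ℕ; zero; suc; _+_; _*_; _∸_; _≤_; _≥_; z≤n; s≤s; s≤s⁻¹)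
open import Data.Nat.ListAction using (sum)
open import Data.Nat.Properties hiding (_≟_)
open import Data.Nat.Tactic.RingSolver using (solve-∀)
open import Data.Product using (_×_; _,_; proj₁; proj₂; ∃-syntax; Σ-syntax)
open import Data.Unit using (tt)
import Data.Vec as Vec
import Data.Vec.Properties as Vec
open import Data.Sum using (_⊎_; inj₁; inj₂; [_,_]′)
open import Data.Sum.Properties using (inj₁-injective; ≡-dec)
open import Function using (_∘_; id; mk⇔)
open import Level using (0ℓ)
open import Relation.Binary.Construct.Closure.ReflexiveTransitive as Star using (Star; ε; _◅_)
open import Relation.Binary.PropositionalEquality hiding ([_])
open import Relation.Nullary using (¬_; Dec; yes; no; does; contradiction; ¬?; _×-dec_; _⊎-dec_; _→-dec_)
import Relation.Nullary.Decidable as Dec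
open import Relation.Nullary.Decidable using (dec-true)
open import Relation.Unary using (Pred; Decidable)

-- Counting in lists.

⊆-length : {A : Set} {xs ys : List A} → Unique xs → xs ⊆ ys → length xs ≤ length ys
⊆-length {xs = []} _ _ = z≤n
⊆-length {xs = x ∷ xs} (x∉xs ∷ u) xs⊆ys with ∈-∃++ (xs⊆ys (here refl))
... | as , bs , refl = begin
  suc (length xs)         ≤⟨ s≤s (⊆-length u xs⊆as++bs) ⟩
  suc (length (as ++ bs)) ≡⟨ ↭-length (shift x as bs) ⟨
  length (as ++ x ∷ bs)   ∎
  where
  open ≤-Reasoning
  xs⊆as++bs : xs ⊆ as ++ bs
  xs⊆as++bs z∈xs with ∈-resp-↭ (shift x as bs) (xs⊆ys (there z∈xs))
  ... | here refl = contradiction refl (All.lookup x∉xs z∈xs)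
  ... | there z∈  = z∈

Unique-resp-↭ : {A : Set} {xs ys : List A} → xs ↭ ys → Unique xs → Unique ys
Unique-resp-↭ p = Permutationₛ.Unique-resp-↭ (setoid _) (↭⇒↭ₛ p)

indicator : {P : Set} → Dec P → ℕ
indicator (yes _) = 1
indicator (no _)  = 0

indicator≤1 : {P : Set} (P? : Dec P) → indicator P? ≤ 1
indicator≤1 (yes _) = ≤-refl
indicator≤1 (no _)  = z≤n

module _ {A : Set} {P : Pred A 0ℓ} (P? : Decidable P) where

  count : List A → ℕ
  count xs = length (filter P? xs)

  count-resp-↭ : ∀ {xs ys} → xs ↭ ys → count xs ≡ count ys
  count-resp-↭ p = ↭-length (filter-↭ P? p)

  count-∷ : ∀ x xs → count (x ∷ xs) ≡ indicator (P? x) + count xs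
  count-∷ x xs with P? x
  ... | yes _ = refl
  ... | no _ = refl

  count-yes : ∀ {x} xs → P x → count (x ∷ xs) ≡ suc (count xs)
  count-yes xs px = cong length (filter-accept P? px)

  count-no : ∀ {x} xs → ¬ P x → count (x ∷ xs) ≡ count xs
  count-no xs ¬px = cong length (filter-reject P? ¬px)

  count-map : {B : Set} (f : B → A) (xs : List B) → length (filter (P? ∘ f) xs) ≡ count (map f xs)
  count-map f [] = refl
  count-map f (x ∷ xs) with P? (f x)
  ... | yes _ = cong suc (count-map f xs)
  ... | no _ = count-map f xs

  count≡0⇒¬ : ∀ {x} xs → count xs ≡ 0 → x ∈ xs → ¬ P x
  count≡0⇒¬ xs eq x∈xs px with filter P? xs | ∈-filter⁺ P? x∈xs px
  ... | _ ∷ _ | _ = contradiction eq λ ()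

  count-full : ∀ xs → length xs ≤ count xs → All P xs
  count-full [] _ = []
  count-full (x ∷ xs) le with P? x
  ... | yes px = px ∷ count-full xs (s≤s⁻¹ le)
  ... | no _ = contradiction (≤-trans le (length-filter P? xs)) 1+n≰n

∣tabulate∣ : ∀ {A : Set} {P : Pred A 0ℓ} (P? : Decidable P) {k} (f : Fin k → A) →
  ∣ Vec.tabulate (does ∘ P? ∘ f) ∣ ≡ count P? (List.tabulate f)
∣tabulate∣ P? {zero} f = refl
∣tabulate∣ P? {suc k} f with P? (f Fin.zero)
... | yes _ = cong suc (∣tabulate∣ P? (f ∘ Fin.suc))
... | no _ = ∣tabulate∣ P? (f ∘ Fin.suc)

All-filter : {A : Set} {P Q : Pred A 0ℓ} (P? : Decidable P) {xs : List A} →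
  All (λ a → P a → Q a) xs → All Q (filter P? xs)
All-filter P? [] = []
All-filter P? {x ∷ xs} (q ∷ qs) with P? x
... | no _ = All-filter P? qs
... | yes px = q px ∷ All-filter P? qs

AllPairs-filter : {A : Set} {P : Pred A 0ℓ} {R : A → A → Set} (P? : Decidable P) {xs : List A} →
  AllPairs (λ a b → P a → P b → R a b) xs → AllPairs R (filter P? xs)
AllPairs-filter P? [] = []
AllPairs-filter P? {x ∷ xs} (rs ∷ rss) with P? x
... | no _ = AllPairs-filter P? rss
... | yes px = All-filter P? (All.map (λ r → r px) rs) ∷ AllPairs-filter P? rss

-- Arithmetic of the packing inequalities

-- The bounds that follow add up their hypotheses to `a ≤ b`; `w` collects the terms common to both
-- sides, which avoids subtraction and leaves two ring identities.
cancel-≤ : ∀ w {a b c d} → a ≤ b → c + w ≡ a → b ≡ d + w → c ≤ d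
cancel-≤ w a≤b eq eq′ = +-cancelʳ-≤ w _ _ (≤-trans (≤-reflexive eq) (≤-trans a≤b (≤-reflexive eq′)))

-- Of the `3 + e` copies of `δ`, three pay for `m + 5` and each of the other `e` is at least
-- `suc k`. The packed vertices are x, of degree `2 + e`, and its successors, of total degree `Σ`.
successors-bound : ∀ {m δ k} e {Σ} → (3 + e) * δ + k ≤ m + ((2 + e) + Σ) →
  m + 5 ≤ 3 * δ → suc k ≤ δ → (2 + e) * k + 3 ≤ Σ + k
successors-bound {m} {δ} {k} e {Σ} h₁ h₂ h₃ =
  cancel-≤ (3 * δ + e * δ + m + 2 + e)
    (+-monoˡ-≤ k (+-mono-≤ (+-mono-≤ h₁ h₂) (*-monoʳ-≤ e h₃)))
    (lhs m δ k e) (rhs m δ k e Σ)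
  where
  lhs : ∀ m δ k e → (2 + e) * k + 3 + (3 * δ + e * δ + m + 2 + e) ≡
    (3 + e) * δ + k + (m + 5) + e * suc k + k
  lhs = solve-∀
  rhs : ∀ m δ k e Σ → m + ((2 + e) + Σ) + 3 * δ + e * δ + k ≡ Σ + k + (3 * δ + e * δ + m + 2 + e)
  rhs = solve-∀

-- The copies of `δ` are split as before, now for the ends of a path, with degree sum `az`, and
-- `suc μ` pivots of total degree `Σ`.
pivots-bound : ∀ {m δ k d Σ} μ {az} → (3 + μ) * δ + k ≤ m + (az + Σ) → az ≤ suc μ + suc k →
  Σ ≤ suc μ * d → m + 5 ≤ 3 * δ → suc k ≤ δ → suc μ * k + 3 ≤ k + suc μ * d
pivots-bound {m} {δ} {k} {d} {Σ} μ {az} h₁ h₂ h₃ h₄ h₅ =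
  cancel-≤ (3 * δ + μ * δ + az + Σ + m + 2 + μ)
    (+-mono-≤ (+-mono-≤ (+-mono-≤ (+-mono-≤ h₁ h₂) h₃) h₄) (*-monoʳ-≤ μ h₅))
    (lhs m δ k Σ μ az) (rhs m δ k d Σ μ az)
  where
  lhs : ∀ m δ k Σ μ az → suc μ * k + 3 + (3 * δ + μ * δ + az + Σ + m + 2 + μ) ≡
    (3 + μ) * δ + k + az + Σ + (m + 5) + μ * suc k
  lhs = solve-∀
  rhs : ∀ m δ k d Σ μ az → m + (az + Σ) + (suc μ + suc k) + suc μ * d + 3 * δ + μ * δ ≡
    k + suc μ * d + (3 * δ + μ * δ + az + Σ + m + 2 + μ)
  rhs = solve-∀

-- The bounds on `az` force `μ` to be at least 2; then `μ * (k - d)` is at most `k - 3` with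
-- `k - d = 2 + e`, so `d` is large.
4≤degree : ∀ {d e k az} μ → k ≡ 2 + d + e → k + 3 ≤ az → az ≤ μ + suc k →
  μ ≡ 0 ⊎ μ * k + 3 ≤ k + μ * d → 4 ≤ d
4≤degree {k = k} zero _ h₁ h₂ _ =
  contradiction (cancel-≤ k (≤-trans h₁ h₂) (lhs k) (rhs k)) λ { (s≤s ()) }
  where
  lhs : ∀ k → 3 + k ≡ k + 3
  lhs = solve-∀
  rhs : ∀ k → suc k ≡ 1 + k
  rhs = solve-∀
4≤degree {k = k} (suc zero) _ h₁ h₂ _ =
  contradiction (cancel-≤ k (≤-trans h₁ h₂) (lhs k) (rhs k)) λ { (s≤s (s≤s ())) }
  where
  lhs : ∀ k → 3 + k ≡ k + 3
  lhs = solve-∀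
  rhs : ∀ k → 1 + suc k ≡ 2 + k
  rhs = solve-∀
4≤degree {d} {e} (suc (suc ν)) refl _ _ (inj₂ h) =
  ≤-trans (m≤m+n 4 (1 + e + ν * (2 + e))) (cancel-≤ ((2 + ν) * d + 2 + e) h (lhs d e ν) (rhs d e ν))
  where
  lhs : ∀ d e ν → 4 + (1 + e + ν * (2 + e)) + ((2 + ν) * d + 2 + e) ≡ (2 + ν) * (2 + d + e) + 3
  lhs = solve-∀
  rhs : ∀ d e ν → 2 + d + e + (2 + ν) * d ≡ d + ((2 + ν) * d + 2 + e)
  rhs = solve-∀

-- As `k - d` is at least 2, packing the pivots gives `2 * μ + 3 ≤ k`, which is what twice
-- `az ≤ μ + suc k` needs. Without pivots, `4 ≤ k` is enough.
pair-small : ∀ {d e k az} μ → k ≡ 2 + d + e → 2 ≤ d → az ≤ μ + suc k →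
  μ ≡ 0 ⊎ μ * k + 3 ≤ k + μ * d → az + az + 1 ≤ 3 * k
pair-small {d} {e} {az = az} μ refl 2≤d h₁ (inj₁ refl) =
  ≤-trans (m≤m+n _ (1 + e)) (cancel-≤ 0 (+-monoˡ-≤ e (+-mono-≤ (+-mono-≤ h₁ h₁) 2≤d)) (lhs az e) (rhs d e))
  where
  lhs : ∀ az e → az + az + 1 + (1 + e) + 0 ≡ az + az + 2 + e
  lhs = solve-∀
  rhs : ∀ d e → suc (2 + d + e) + suc (2 + d + e) + d + e ≡ 3 * (2 + d + e) + 0
  rhs = solve-∀
pair-small {d} {e} {az = az} μ refl 2≤d h₁ (inj₂ h₂) =
  ≤-trans (m≤m+n _ (μ * e)) (cancel-≤ (μ * d + μ + μ + 2) (+-mono-≤ (+-mono-≤ h₁ h₁) h₂) (lhs az μ d e) (rhs μ d e))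
  where
  lhs : ∀ az μ d e → az + az + 1 + μ * e + (μ * d + μ + μ + 2) ≡ az + az + (μ * (2 + d + e) + 3)
  lhs = solve-∀
  rhs : ∀ μ d e → μ + suc (2 + d + e) + (μ + suc (2 + d + e)) + (2 + d + e + μ * d) ≡
    3 * (2 + d + e) + (μ * d + μ + μ + 2)
  rhs = solve-∀

two-large : ∀ {k Σ} e {a b} → (2 + e) * k + 3 ≤ a + (b + Σ) + k → Σ ≤ e * k → k + 3 ≤ a + b
two-large {k} {Σ} e {a} {b} h₁ h₂ = cancel-≤ (k + e * k + Σ) (+-mono-≤ h₁ h₂) (lhs k e Σ) (rhs k e Σ a b)
  where
  lhs : ∀ k e Σ → k + 3 + (k + e * k + Σ) ≡ (2 + e) * k + 3 + Σ
  lhs = solve-∀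
  rhs : ∀ k e Σ a b → a + (b + Σ) + k + e * k ≡ a + b + (k + e * k + Σ)
  rhs = solve-∀

-- Bounding `Σ` leaves four degrees of sum at least `3 * k + 3`, while the two pairs together stay
-- below `3 * k`.
four-small : ∀ {k Σ} f {a b c d} → (4 + f) * k + 3 ≤ a + (b + (c + (d + Σ))) + k → Σ ≤ f * k →
  (a + b) + (a + b) + 1 ≤ 3 * k → (c + d) + (c + d) + 1 ≤ 3 * k → ⊥
four-small {k} {Σ} f {a} {b} {c} {d} h₁ h₂ h₃ h₄ = contradiction
  (cancel-≤ w {c = 8} {0} (+-mono-≤ (+-mono-≤ (+-mono-≤ h₁ h₂) (+-mono-≤ h₁ h₂)) (+-mono-≤ h₃ h₄))
    (lhs k Σ f a b c d) (rhs k Σ f a b c d)) λ ()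
  where
  w = 8 * k + 2 * (f * k) + 2 * Σ + 2 * (a + b + c + d)
  lhs : ∀ k Σ f a b c d → 8 + (8 * k + 2 * (f * k) + 2 * Σ + 2 * (a + b + c + d)) ≡
    ((4 + f) * k + 3 + Σ) + ((4 + f) * k + 3 + Σ) + ((a + b) + (a + b) + 1 + ((c + d) + (c + d) + 1))
  lhs = solve-∀
  rhs : ∀ k Σ f a b c d → (a + (b + (c + (d + Σ))) + k + f * k) + (a + (b + (c + (d + Σ))) + k + f * k) +
    (3 * k + 3 * k) ≡ 0 + (8 * k + 2 * (f * k) + 2 * Σ + 2 * (a + b + c + d))
  rhs = solve-∀

-- Here `k = 3 + g`. With all hypotheses tight the two sides differ by exactly one, so the 1 in the
-- bound on `Σ` could not be a 2.
tail-bound : ∀ {m δ Σ t} g → (3 + g) * δ + (3 + g) ≤ m + (t + Σ) → t ≤ 2 + g → Σ ≤ 1 + (2 + g) * (2 + g) →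
  m + 5 ≤ 3 * δ → suc (3 + g) ≤ δ → ⊥
tail-bound {m} {δ} {Σ} {t} g h₁ h₂ h₃ h₄ h₅ = contradiction
  (cancel-≤ w {c = 1} {0} (+-mono-≤ (+-mono-≤ (+-mono-≤ (+-mono-≤ h₁ h₂) h₃) h₄) (*-monoʳ-≤ g h₅))
    (lhs m δ Σ t g) (rhs m δ Σ t g)) λ ()
  where
  w = (3 + g) * δ + m + t + Σ + g * (4 + g) + (7 + g)
  lhs : ∀ m δ Σ t g → 1 + ((3 + g) * δ + m + t + Σ + g * (4 + g) + (7 + g)) ≡
    (3 + g) * δ + (3 + g) + t + Σ + (m + 5) + g * suc (3 + g)
  lhs = solve-∀
  rhs : ∀ m δ Σ t g → m + (t + Σ) + (2 + g) + (1 + (2 + g) * (2 + g)) + 3 * δ + g * δ ≡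
    0 + ((3 + g) * δ + m + t + Σ + g * (4 + g) + (7 + g))
  rhs = solve-∀

three-apart-bound : ∀ {m δ k x u v} → 3 * δ + k ≤ m + (x + (u + (v + 0))) → x ≤ 2 → u + v ≤ suc k →
  m + 5 ≤ 3 * δ → ⊥
three-apart-bound {m} {δ} {k} {x} {u} {v} h₁ h₂ h₃ h₄ = contradiction
  (cancel-≤ w {c = 4} {2} (+-mono-≤ (+-mono-≤ (+-mono-≤ h₁ h₂) h₃) h₄) (lhs m δ k x u v) (rhs m δ k x u v)) λ { (s≤s (s≤s ())) }
  where
  w = 3 * δ + m + k + x + u + v + 1
  lhs : ∀ m δ k x u v → 4 + (3 * δ + m + k + x + u + v + 1) ≡ 3 * δ + k + x + (u + v) + (m + 5)
  lhs = solve-∀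
  rhs : ∀ m δ k x u v → m + (x + (u + (v + 0))) + 2 + suc k + 3 * δ ≡ 2 + (3 * δ + m + k + x + u + v + 1)
  rhs = solve-∀

sum-map-≤ : {A : Set} (f : A → ℕ) {d : ℕ} {xs : List A} → All (λ x → f x ≤ d) xs →
  sum (map f xs) ≤ length xs * d
sum-map-≤ f [] = z≤n
sum-map-≤ f (p ∷ ps) = +-mono-≤ p (sum-map-≤ f ps)

AllPairs-lookup : {A : Set} {R : A → A → Set} → (∀ {a b} → R a b → R b a) → {xs : List A} →
  AllPairs R xs → ∀ {a b} → a ∈ xs → b ∈ xs → a ≢ b → R a b
AllPairs-lookup sym (rs ∷ rss) (here refl) (here refl) a≢b = contradiction refl a≢b
AllPairs-lookup sym (rs ∷ rss) (here refl) (there b∈) _ = All.lookup rs b∈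
AllPairs-lookup sym (rs ∷ rss) (there a∈) (here refl) _ = sym (All.lookup rs a∈)
AllPairs-lookup sym (rs ∷ rss) (there a∈) (there b∈) a≢b = AllPairs-lookup sym rss a∈ b∈ a≢b

elements : ∀ {n} → Subset n → List (Fin n)
elements p = filter (Subset._∈? p) (allFin _)

∣p∣≡length-elements : ∀ {n} (p : Subset n) → ∣ p ∣ ≡ length (elements p)
∣p∣≡length-elements p = trans (cong ∣_∣ (sym (members p))) (∣tabulate∣ (Subset._∈? p) id)
  where
  members : ∀ {n} (p : Subset n) → Vec.tabulate (does ∘ (Subset._∈? p)) ≡ p
  members Vec.[] = refl
  members (false Vec.∷ p) = cong (false Vec.∷_) (members p)
  members (true Vec.∷ p) = cong (true Vec.∷_) (members p)

-- Neighbourhoods outside S and the packing inequality.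

module _ {n m} (G : Bigraph n m) where
  open Bigraph G

  open import Data.List.Membership.DecPropositional (Fin._≟_ {m}) using (_∈?_)
  open import Data.List.Membership.DecPropositional (Fin._≟_ {n}) using () renaming (_∈?_ to _∈ˣ?_)

  private
    X = Fin n
    Y = Fin m

  deg : X → List Y → ℕ
  deg v = count (v —?_)

  neighbourList : X → List Y
  neighbourList v = filter (v —?_) (allFin m)

  Apart : List Y → X → X → Set
  Apart S u v = ∀ {c} → c ∉ S → u — c → v — c → ⊥

  outside : List Y → X → List Y
  outside S v = filter (λ y → ¬? (y ∈? S)) (neighbourList v)

  degree≤ : ∀ v S → degree v ≤ length (outside S v) + deg v S
  degree≤ v S = begin
    degree v                                     ≡⟨ ∣tabulate∣ (v —?_) id ⟩
    length (neighbourList v)                     ≤⟨ ⊆-length (Unique.filter⁺ _ (Unique.allFin⁺ m)) split ⟩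
    length (outside S v ++ filter (v —?_) S)     ≡⟨ length-++ (outside S v) ⟩
    length (outside S v) + deg v S               ∎
    where
    open ≤-Reasoning
    split : neighbourList v ⊆ outside S v ++ filter (v —?_) S
    split {y} y∈ with y ∈? S
    ... | yes y∈S = ∈-++⁺ʳ (outside S v) (∈-filter⁺ (v —?_) y∈S (proj₂ (∈-filter⁻ (v —?_) {xs = allFin m} y∈)))
    ... | no y∉S = ∈-++⁺ˡ (∈-filter⁺ _ y∈ y∉S)

  ∈-outside : ∀ {S v y} → y ∈ outside S v → y ∉ S × v — y
  ∈-outside {S} {v} y∈ with ∈-filter⁻ (λ y → ¬? (y ∈? S)) {xs = neighbourList v} y∈
  ... | y∈N , y∉S = y∉S , proj₂ (∈-filter⁻ (v —?_) {xs = allFin m} y∈N)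

  -- Outside `S` the neighbourhoods of pairwise apart vertices are disjoint, so together with `S`
  -- they fit into Y; that of v has at least `δ - deg v S` elements there.
  packing : ∀ {δ S vs} → (∀ v → δ ≤ degree v) → Unique S → AllPairs (Apart S) vs →
    length vs * δ + length S ≤ m + sum (map (λ v → deg v S) vs)
  packing {δ} {S} {vs} δ≤ uS apart = begin
    length vs * δ + length S                             ≤⟨ +-monoˡ-≤ (length S) (total vs) ⟩
    length (union vs) + degs vs + length S               ≡⟨ rearrange (length (union vs)) (degs vs) (length S) ⟩
    length (union vs) + length S + degs vs               ≡⟨ cong (_+ degs vs) (length-++ (union vs)) ⟨
    length (union vs ++ S) + degs vs                     ≤⟨ +-monoˡ-≤ (degs vs) (⊆-length unique λ {y} _ → ∈-allFin y) ⟩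
    length (allFin m) + degs vs                          ≡⟨ cong (_+ degs vs) (length-tabulate id) ⟩
    m + degs vs                                          ∎
    where
    open ≤-Reasoning
    degs : List X → ℕ
    degs = sum ∘ map (λ v → deg v S)
    union : List X → List Y
    union = concat ∘ map (outside S)
    rearrange : ∀ a b c → a + b + c ≡ a + c + b
    rearrange = solve-∀
    interchange : ∀ a b c d → (a + b) + (c + d) ≡ (a + c) + (b + d)
    interchange = solve-∀
    total : ∀ vs → length vs * δ ≤ length (union vs) + degs vs
    total [] = z≤n
    total (v ∷ vs) = begin
      δ + length vs * δ                                                    ≤⟨ +-mono-≤ (≤-trans (δ≤ v) (degree≤ v S)) (total vs) ⟩
      (length (outside S v) + deg v S) + (length (union vs) + degs vs)     ≡⟨ interchange (length (outside S v)) _ _ _ ⟩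
      (length (outside S v) + length (union vs)) + (deg v S + degs vs)     ≡⟨ cong (_+ (deg v S + degs vs)) (length-++ (outside S v)) ⟨
      length (union (v ∷ vs)) + degs (v ∷ vs)                              ∎
    uniques : ∀ vs → All Unique (map (outside S) vs)
    uniques [] = []
    uniques (v ∷ vs) = Unique.filter⁺ _ (Unique.filter⁺ _ (Unique.allFin⁺ m)) ∷ uniques vs
    disjoint : AllPairs Disjoint (map (outside S) vs)
    disjoint = AllPairs.map⁺ (AllPairs.map
      (λ {u} {v} ap {y} (y∈u , y∈v) → let y∉S , u—y = ∈-outside y∈u in ap y∉S u—y (proj₂ (∈-outside y∈v))) apart)
    ∉S : ∀ vs {y} → y ∈ union vs → y ∉ S
    ∉S (v ∷ vs) y∈ with ∈-++⁻ (outside S v) y∈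
    ... | inj₁ y∈v = proj₁ (∈-outside y∈v)
    ... | inj₂ y∈vs = ∉S vs y∈vs
    unique : Unique (union vs ++ S)
    unique = Unique.++⁺ (Unique.concat⁺ (uniques vs) disjoint) uS λ (y∈u , y∈S) → ∉S vs y∈u y∈S

  -- Alternating paths, their bags and their links.

  -- Distinctness is not built in: it comes from a bag equal, up to order, to a pair of
  -- duplicate-free lists. Rerouting thus has no side conditions.
  data Path : X → X → Set where
    end  : ∀ u → Path u u
    step : ∀ u {w v} y → u — y → w — y → Path w v → Path u v

  -- The two vertex lists of a path, up to permutation. Rerouting a path does not
  -- change its bag, and the commutative monoid solver checks this.
  Bag : CommutativeMonoid _ _
  Bag = DirectProduct.commutativeMonoid (++-commutativeMonoid {A = X}) (++-commutativeMonoid {A = Y})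

  open CommutativeMonoid Bag using (Carrier; _≈_; _∙_; ∙-cong; ∙-congˡ; ∙-congʳ)
    renaming (refl to ≈-refl; sym to ≈-sym; trans to ≈-trans)
  open CommutativeMonoidSolver Bag using (solve; _⊕_; _⊜_)

  ιˣ : X → Carrier
  ιˣ x = x ∷ [] , []

  ιʸ : Y → Carrier
  ιʸ y = [] , y ∷ []

  bag : ∀ {u v} → Path u v → Carrier
  bag (end u)          = ιˣ u
  bag (step u y _ _ P) = ιˣ u ∙ (ιʸ y ∙ bag P)

  join : ∀ {u a b v} → Path u a → ∀ y → a — y → b — y → Path b v → Path u v
  join (end u) y e f Q = step u y e f Q
  join (step u y′ e′ f′ P) y e f Q = step u y′ e′ f′ (join P y e f Q)

  bag-join : ∀ {u a b v} (P : Path u a) y (e : a — y) (f : b — y) (Q : Path b v) →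
    bag (join P y e f Q) ≈ bag P ∙ (ιʸ y ∙ bag Q)
  bag-join (end u) y e f Q = ≈-refl
  bag-join (step u y′ e′ f′ P) y e f Q = ≈-trans
    (∙-congˡ {ιˣ u} (∙-congˡ {ιʸ y′} (bag-join P y e f Q)))
    (solve 4 (λ u y′ p q → (u ⊕ (y′ ⊕ (p ⊕ q))) ⊜ ((u ⊕ (y′ ⊕ p)) ⊕ q)) ≈-refl
      (ιˣ u) (ιʸ y′) (bag P) (ιʸ y ∙ bag Q))

  Seg : X → X → Carrier → Set
  Seg u v β = Σ[ P ∈ Path u v ] bag P ≈ β

  reverse : ∀ {u v} (P : Path u v) → Seg v u (bag P)
  reverse (end u) = end u , ≈-refl
  reverse (step u y e f P) = let (Q , q) = reverse P in join Q y f e (end u) ,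
    ≈-trans (bag-join Q y f e (end u)) (≈-trans (∙-congʳ {ιʸ y ∙ ιˣ u} q)
      (solve 3 (λ u y p → (p ⊕ (y ⊕ u)) ⊜ (u ⊕ (y ⊕ p))) ≈-refl (ιˣ u) (ιʸ y) (bag P)))

  join-cong : ∀ {α α′ β β′} y → α ≈ α′ → β ≈ β′ → α ∙ (ιʸ y ∙ β) ≈ α′ ∙ (ιʸ y ∙ β′)
  join-cong {α} {α′} y p q = ∙-cong {α} {α′} p (∙-congˡ {ιʸ y} q)

  bag-join₂ : ∀ {u a b c d v} (A : Path u a) y (e : a — y) (f : b — y)
    (B : Path b c) y′ (e′ : c — y′) (f′ : d — y′) (C : Path d v) →
    bag (join A y e f (join B y′ e′ f′ C)) ≈ bag A ∙ (ιʸ y ∙ (bag B ∙ (ιʸ y′ ∙ bag C)))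
  bag-join₂ A y e f B y′ e′ f′ C = ≈-trans (bag-join A y e f _)
    (join-cong {bag A} y ≈-refl (bag-join B y′ e′ f′ C))

  ⟪_⟫ : ∀ {u v} (P : Path u v) → Seg u v (bag P)
  ⟪ P ⟫ = P , ≈-refl

  infixr 5 _⟨_,_,_⟩_
  _⟨_,_,_⟩_ : ∀ {u a b v α β} → Seg u a α → ∀ y → a — y → b — y → Seg b v β →
    Seg u v (α ∙ (ιʸ y ∙ β))
  (P , p) ⟨ y , e , f ⟩ (Q , q) = join P y e f Q ,
    ≈-trans (bag-join P y e f Q) (join-cong {bag P} y p q)

  rebag : ∀ {u v α β} → α ≈ β → Seg u v α → Seg u v β
  rebag eq (P , p) = P , ≈-trans p eq

  -- A link records w and the Y-vertex before it. The rest of the path is kept so that `Pivot` can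
  -- see which Y-vertex follows w.
  Link : X → Set
  Link v = Σ[ w ∈ X ] Y × Path w v

  links : ∀ {u v} → Path u v → List (Link v)
  links (end _) = []
  links (step _ {w} y _ _ P) = (w , y , P) ∷ links P

  links-All : ∀ {u v} {T : Link v → Set} (P : Path u v) →
    (∀ {a w} (A : Path u a) y (e : a — y) (f : w — y) (C : Path w v) →
      join A y e f C ≡ P → T (w , y , C)) →
    All T (links P)
  links-All (end _) h = []
  links-All (step u y e f P) h = h (end u) y e f P refl ∷
    links-All P λ A y′ e′ f′ C eq → h (step u y e f A) y′ e′ f′ C (cong (step u y e f) eq)

  links-AllPairs : ∀ {u v} {R : Link v → Link v → Set} (P : Path u v) →
    (∀ {a b c d} (A : Path u a) y (e : a — y) (f : b — y)
      (B : Path b c) y′ (e′ : c — y′) (f′ : d — y′) (C : Path d v) →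
      join A y e f (join B y′ e′ f′ C) ≡ P → R (b , y , join B y′ e′ f′ C) (d , y′ , C)) →
    AllPairs R (links P)
  links-AllPairs (end _) h = []
  links-AllPairs (step u y e f P) h =
    links-All P (λ { B y′ e′ f′ C refl → h (end u) y e f B y′ e′ f′ C refl }) ∷
    links-AllPairs P λ A y₁ e₁ f₁ B y₂ e₂ f₂ C eq →
      h (step u y e f A) y₁ e₁ f₁ B y₂ e₂ f₂ C (cong (step u y e f) eq)

  links-xs : ∀ {u v} (P : Path u v) → u ∷ map proj₁ (links P) ≡ proj₁ (bag P)
  links-xs (end _) = refl
  links-xs (step u y e f P) = cong (u ∷_) (links-xs P)

  links-ys : ∀ {u v} (P : Path u v) → map (proj₁ ∘ proj₂) (links P) ≡ proj₂ (bag P)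
  links-ys (end _) = refl
  links-ys (step u y e f P) = cong (y ∷_) (links-ys P)

  -- Detours through the vertex left out of a cycle.

  -- For LS = (L , S): a cycle through L minus x whose Y-part is S, cut open at y₀.
  record Near (x : X) (LS : Carrier) : Set where
    constructor near
    field
      {first last} : X
      path   : Path first last
      y₀     : Y
      first— : first — y₀
      last—  : last — y₀
      covers : ιˣ x ∙ (ιʸ y₀ ∙ bag path) ≈ LS

  toNear : ∀ {x u p α LS} → Seg u p α → ∀ y → u — y → p — y → ιˣ x ∙ (ιʸ y ∙ α) ≈ LS → Near x LS
  toNear {x} (P , q) y e f eq = near P y e f (≈-trans (∙-congˡ {ιˣ x} (∙-congˡ {ιʸ y} q)) eq)

  module _ {L S x u p} (P : Path u p) {y₀} (u— : u — y₀) (p— : p — y₀)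
    (covers : ιˣ x ∙ (ιʸ y₀ ∙ bag P) ≈ (L , S)) where

    cycleLinks : List (Link p)
    cycleLinks = (u , y₀ , P) ∷ links P

    private
      within : ∀ {β} → bag P ≈ β → ιˣ x ∙ (ιʸ y₀ ∙ β) ≈ (L , S)
      within {β} q = ≈-trans (∙-congˡ {ιˣ x} (∙-congˡ {ιʸ y₀} (≈-sym q))) covers

    -- The path goes from x to y, back along the cycle to u, over y₀ to p and back to the successor
    -- of y. For the closing link it enters at p directly.
    detour-from-x : All (λ l → x — proj₁ (proj₂ l) → Seg x (proj₁ l) (L , S)) cycleLinks
    detour-from-x = (λ x—y₀ → rebag covers (⟪ end x ⟫ ⟨ y₀ , x—y₀ , p— ⟩ reverse P))
      ∷ links-All P λ { A y e f C refl x—y → rebag (≈-trans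
          (solve 5 (λ x y y₀ a c → (x ⊕ (y ⊕ (a ⊕ (y₀ ⊕ c)))) ⊜ (x ⊕ (y₀ ⊕ (a ⊕ (y ⊕ c))))) ≈-refl
            (ιˣ x) (ιʸ y) (ιʸ y₀) (bag A) (bag C))
          (within (bag-join A y e f C)))
          (⟪ end x ⟫ ⟨ y , x—y , e ⟩ reverse A ⟨ y₀ , u— , p— ⟩ reverse C) }

    -- If x is adjacent to y and y′, both on the cycle, the successors of y and y′
    -- are joined by the path that enters x from y′ and leaves it to y.
    detour : AllPairs (λ l l′ → x — proj₁ (proj₂ l) → x — proj₁ (proj₂ l′) →
      Seg (proj₁ l) (proj₁ l′) (L , S)) cycleLinks
    detour = links-All P (λ { A y e f C refl x—y₀ x—y → rebag (≈-trans
          (solve 5 (λ x y y₀ a c → (a ⊕ (y ⊕ (x ⊕ (y₀ ⊕ c)))) ⊜ (x ⊕ (y₀ ⊕ (a ⊕ (y ⊕ c))))) ≈-refl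
            (ιˣ x) (ιʸ y) (ιʸ y₀) (bag A) (bag C))
          (within (bag-join A y e f C)))
          (⟪ A ⟫ ⟨ y , e , x—y ⟩ ⟪ end x ⟫ ⟨ y₀ , x—y₀ , p— ⟩ reverse C) })
      ∷ links-AllPairs P λ { A y e f B y′ e′ f′ C refl x—y x—y′ → rebag (≈-trans
          (solve 7 (λ x y y′ y₀ a b c → (b ⊕ (y′ ⊕ (x ⊕ (y ⊕ (a ⊕ (y₀ ⊕ c)))))) ⊜
              (x ⊕ (y₀ ⊕ (a ⊕ (y ⊕ (b ⊕ (y′ ⊕ c))))))) ≈-refl
            (ιˣ x) (ιʸ y) (ιʸ y′) (ιʸ y₀) (bag A) (bag B) (bag C))
          (within (bag-join₂ A y e f B y′ e′ f′ C)))
          (⟪ B ⟫ ⟨ y′ , e′ , x—y′ ⟩ ⟪ end x ⟫ ⟨ y , x—y , e ⟩ reverse A ⟨ y₀ , u— , p— ⟩ reverse C) }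

    via? : Decidable (λ (l : Link p) → x — proj₁ (proj₂ l))
    via? l = x —? proj₁ (proj₂ l)

    successors : List X
    successors = map proj₁ (filter via? cycleLinks)

    length-successors : length successors ≡ deg x S
    length-successors = begin
      length (map proj₁ (filter via? cycleLinks))       ≡⟨ length-map proj₁ (filter via? cycleLinks) ⟩
      count via? cycleLinks                             ≡⟨ count-map (x —?_) (proj₁ ∘ proj₂) cycleLinks ⟩
      deg x (y₀ ∷ map (proj₁ ∘ proj₂) (links P))        ≡⟨ cong (λ ys → deg x (y₀ ∷ ys)) (links-ys P) ⟩
      deg x (y₀ ∷ proj₂ (bag P))                        ≡⟨ count-resp-↭ (x —?_) (proj₂ covers) ⟩
      deg x S                                           ∎
      where open ≡-Reasoning

    successors-paths : AllPairs (λ v w → Seg v w (L , S)) (x ∷ successors)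
    successors-paths = All.map⁺ (All-filter via? detour-from-x) ∷ AllPairs.map⁺ (AllPairs-filter via? detour)

    -- Here x uses every link but possibly the closing one, so the family consists of x and all
    -- X-vertices of the path after the first.
    tail-paths : All (x —_) (proj₂ (bag P)) → AllPairs (λ v w → Seg v w (L , S)) (x ∷ map proj₁ (links P))
    tail-paths x— = subst (λ ls → AllPairs _ (x ∷ map proj₁ ls))
      (filter-all via? (All.map⁻ (subst (All (x —_)) (sym (links-ys P)) x—)))
      (All.map⁺ (All-filter via? (All.tail detour-from-x)) ∷
       AllPairs.map⁺ (AllPairs-filter via? (AllPairs.tail detour)))

  -- Pivots of a path through L.

  module _ {L S a z} (P : Path a z) (covers : bag P ≈ (L , S)) where

    -- The link (w , y , …) ends at w, so y precedes w on P and y′ follows it.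
    Pivot : Link z → Set
    Pivot (_ , y , end _) = ⊥
    Pivot (_ , y , step _ y′ _ _ _) = z — y × a — y′

    pivot? : Decidable Pivot
    pivot? (_ , y , end _) = no λ ()
    pivot? (_ , y , step _ y′ _ _ _) = (z —? y) ×-dec (a —? y′)

    pivots : List X
    pivots = map proj₁ (filter pivot? (links P))

    -- The part before y, a jump over y to z and the way back to the vertex after y′ form a path
    -- that y′ closes; only w is left out.
    pivot-near : All (λ w → Near w (L , S)) pivots
    pivot-near = All.map⁺ (All-filter pivot? (links-All P λ
      { A y e f C@(step w y′ e′ f′ C′) refl (z—y , a—y′) →
        toNear (⟪ A ⟫ ⟨ y , e , z—y ⟩ reverse C′) y′ a—y′ f′ (≈-trans
          (solve 5 (λ w y y′ a c → (w ⊕ (y′ ⊕ (a ⊕ (y ⊕ c)))) ⊜ (a ⊕ (y ⊕ (w ⊕ (y′ ⊕ c))))) ≈-refl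
            (ιˣ w) (ιʸ y) (ιʸ y′) (bag A) (bag C′))
          (≈-trans (≈-sym (bag-join A y e f C)) covers)) }))

    -- The path neighbours y and y′ of w are two entries of `S`. This excludes pivots once left-out
    -- vertices have degree at most one.
    pivot-degree : All (λ w → 2 ≤ deg w S) pivots
    pivot-degree = All.map⁺ (All-filter pivot? (links-All P λ
      { A y e f C@(step w y′ e′ f′ C′) refl _ →
        let two = ≈-trans
              (solve 5 (λ w y y′ a c → (y ⊕ (y′ ⊕ (w ⊕ (a ⊕ c)))) ⊜ (a ⊕ (y ⊕ (w ⊕ (y′ ⊕ c))))) ≈-refl
                (ιˣ w) (ιʸ y) (ιʸ y′) (bag A) (bag C′))
              (≈-trans (≈-sym (bag-join A y e f C)) covers)
            ys = proj₂ (bag A) ++ proj₂ (bag C′)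
        in begin
          2                         ≤⟨ s≤s (s≤s z≤n) ⟩
          2 + deg w ys              ≡⟨ cong suc (count-yes (w —?_) ys e′) ⟨
          1 + deg w (y′ ∷ ys)       ≡⟨ count-yes (w —?_) (y′ ∷ ys) f ⟨
          deg w (y ∷ y′ ∷ ys)       ≡⟨ count-resp-↭ (w —?_) (proj₂ two) ⟩
          deg w S                   ∎ }))
      where open ≤-Reasoning

    -- From a to a pivot only the edge of z is used, from z only the edge of a; between two pivots,
    -- the edge of a at the earlier and the edge of z at the later one.
    pivot-paths : AllPairs (λ v w → Seg v w (L , S)) (a ∷ z ∷ pivots)
    pivot-paths = ((P , covers) ∷ All.map⁺ (All-filter pivot? from-start)) ∷
      All.map⁺ (All-filter pivot? from-end) ∷ AllPairs.map⁺ (AllPairs-filter pivot? between)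
      where
      from-start : All (λ l → Pivot l → Seg a (proj₁ l) (L , S)) (links P)
      from-start = links-All P λ
        { A y e f C@(step _ _ _ _ _) refl (z—y , _) →
          rebag (≈-trans (≈-sym (bag-join A y e f C)) covers) (⟪ A ⟫ ⟨ y , e , z—y ⟩ reverse C) }

      from-end : All (λ l → Pivot l → Seg z (proj₁ l) (L , S)) (links P)
      from-end = links-All P λ
        { A y e f C@(step w y′ e′ f′ C′) refl (_ , a—y′) → rebag (≈-trans
            (solve 5 (λ w y y′ a c → ((c ⊕ (y′ ⊕ (a ⊕ (y ⊕ w))))) ⊜ (a ⊕ (y ⊕ (w ⊕ (y′ ⊕ c))))) ≈-refl
              (ιˣ w) (ιʸ y) (ιʸ y′) (bag A) (bag C′))
            (≈-trans (≈-sym (bag-join A y e f C)) covers))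
            (reverse C′ ⟨ y′ , f′ , a—y′ ⟩ ⟪ A ⟫ ⟨ y , e , f ⟩ ⟪ end w ⟫) }

      between : AllPairs (λ l l′ → Pivot l → Pivot l′ → Seg (proj₁ l) (proj₁ l′) (L , S)) (links P)
      between = links-AllPairs P λ
        -- For consecutive pivots the Y-vertex between them is adjacent to both a and z.
        { A y e f (end b) y′ e′ f′ C@(step _ _ _ _ _) refl (_ , a—y′) (z—y′ , _) → rebag (≈-trans
            (solve 5 (λ b y y′ a c → (b ⊕ (y ⊕ (a ⊕ (y′ ⊕ c)))) ⊜ (a ⊕ (y ⊕ (b ⊕ (y′ ⊕ c))))) ≈-refl
              (ιˣ b) (ιʸ y) (ιʸ y′) (bag A) (bag C))
            (≈-trans (≈-sym (bag-join A y e f _)) covers))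
            (⟪ end b ⟫ ⟨ y , f , e ⟩ reverse A ⟨ y′ , a—y′ , z—y′ ⟩ reverse C)
        ; A y e f B@(step b y″ e″ f″ B′) y′ e′ f′ C@(step _ _ _ _ _) refl (_ , a—y″) (z—y′ , _) → rebag (≈-trans
            (solve 7 (λ b y y″ y′ a b′ c → (b ⊕ (y ⊕ (a ⊕ (y″ ⊕ (b′ ⊕ (y′ ⊕ c)))))) ⊜
                (a ⊕ (y ⊕ ((b ⊕ (y″ ⊕ b′)) ⊕ (y′ ⊕ c))))) ≈-refl
              (ιˣ b) (ιʸ y) (ιʸ y″) (ιʸ y′) (bag A) (bag B′) (bag C))
            (≈-trans (≈-sym (bag-join₂ A y e f B y′ e′ f′ C)) covers))
            (⟪ end b ⟫ ⟨ y , f , e ⟩ reverse A ⟨ y″ , a—y″ , f″ ⟩ ⟪ B′ ⟫ ⟨ y′ , e′ , z—y′ ⟩ reverse C) }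

    -- An edge from z to a Y-vertex is paired with an edge from a to the next one; both exist
    -- exactly at a pivot. The last Y-vertex for z and the first for a stay unpaired, whence `suc`.
    degree-sum : deg a S + deg z S ≤ length pivots + suc (length S)
    degree-sum = begin
      deg a S + deg z S                                        ≡⟨ cong₂ _+_ (count-resp-↭ (a —?_) (proj₂ covers)) (count-resp-↭ (z —?_) (proj₂ covers)) ⟨
      deg a (proj₂ (bag P)) + deg z (proj₂ (bag P))            ≤⟨ bound P ⟩
      count pivot? (links P) + length (proj₂ (bag P)) + lead P ≤⟨ +-monoʳ-≤ (count pivot? (links P) + length (proj₂ (bag P))) (lead≤1 P) ⟩
      count pivot? (links P) + length (proj₂ (bag P)) + 1      ≡⟨ +-assoc (count pivot? (links P)) _ 1 ⟩
      count pivot? (links P) + (length (proj₂ (bag P)) + 1)    ≡⟨ cong₂ _+_ (sym (length-map proj₁ (filter pivot? (links P)))) (trans (+-comm _ 1) (cong suc (↭-length (proj₂ covers)))) ⟩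
      length pivots + suc (length S)                           ∎
      where
      open ≤-Reasoning
      -- `lead` is the edge of a that is still unpaired; the induction pairs it one link earlier.
      lead : ∀ {w} → Path w z → ℕ
      lead (end _) = 0
      lead (step _ y _ _ _) = indicator (a —? y)
      lead≤1 : ∀ {w} (C : Path w z) → lead C ≤ 1
      lead≤1 (end _) = z≤n
      lead≤1 (step _ y _ _ _) = indicator≤1 (a —? y)
      pivot-lead : ∀ {w} y (C : Path w z) → indicator (z —? y) + lead C ≤ indicator (pivot? (w , y , C)) + 1
      pivot-lead y (end _) = ≤-trans (≤-reflexive (+-identityʳ _)) (indicator≤1 (z —? y))
      pivot-lead y (step _ y′ _ _ _) with z —? y | a —? y′
      ... | yes _ | yes _ = ≤-refl
      ... | yes _ | no _ = ≤-refl
      ... | no _ | yes _ = ≤-refl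
      ... | no _ | no _ = z≤n
      regroup : ∀ i α j ζ l → (i + α) + (j + ζ) + l ≡ (j + l) + (α + ζ) + i
      regroup = solve-∀
      regroup′ : ∀ q p s l i → (q + 1) + (p + s + l) + i ≡ q + p + suc s + i + l
      regroup′ = solve-∀
      bound : ∀ {w} (C : Path w z) → deg a (proj₂ (bag C)) + deg z (proj₂ (bag C)) ≤
        count pivot? (links C) + length (proj₂ (bag C)) + lead C
      bound (end _) = z≤n
      bound (step _ y _ _ C) = +-cancelʳ-≤ (lead C) _ _ (begin
        deg a (y ∷ ys) + deg z (y ∷ ys) + lead C
          ≡⟨ cong (_+ lead C) (cong₂ _+_ (count-∷ (a —?_) y ys) (count-∷ (z —?_) y ys)) ⟩
        (ia + deg a ys) + (iz + deg z ys) + lead C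
          ≡⟨ regroup ia (deg a ys) iz (deg z ys) (lead C) ⟩
        (iz + lead C) + (deg a ys + deg z ys) + ia
          ≤⟨ +-monoˡ-≤ ia (+-mono-≤ (pivot-lead y C) (bound C)) ⟩
        (ip + 1) + (count pivot? (links C) + length ys + lead C) + ia
          ≡⟨ regroup′ ip (count pivot? (links C)) (length ys) (lead C) ia ⟩
        ip + count pivot? (links C) + suc (length ys) + ia + lead C
          ≡⟨ cong (λ t → t + suc (length ys) + ia + lead C) (count-∷ pivot? (_ , y , C) (links C)) ⟨
        count pivot? ((_ , y , C) ∷ links C) + suc (length ys) + ia + lead C ∎)
        where
        ys = proj₂ (bag C)
        ia = indicator (a —? y)
        iz = indicator (z —? y)
        ip = indicator (pivot? (_ , y , C))

  -- Splitting paths and rotating cycles.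

  xsOf : ∀ {u v} → Path u v → List X
  xsOf P = proj₁ (bag P)

  ysOf : ∀ {u v} → Path u v → List Y
  ysOf P = proj₂ (bag P)

  length-bag : ∀ {u v} (P : Path u v) → length (xsOf P) ≡ suc (length (ysOf P))
  length-bag (end _) = refl
  length-bag (step _ _ _ _ P) = cong suc (length-bag P)

  first∈ : ∀ {u v} (P : Path u v) → u ∈ xsOf P
  first∈ (end _) = here refl
  first∈ (step _ _ _ _ _) = here refl

  last∈ : ∀ {u v} (P : Path u v) → v ∈ xsOf P
  last∈ (end _) = here refl
  last∈ (step _ _ _ _ P) = there (last∈ P)

  record Split {u p} (P : Path u p) : Set where
    constructor split
    field
      {left right} : X
      before : Path u left
      y      : Y
      left—  : left — y
      right— : right — y
      after  : Path right p
      joined : join before y left— right— after ≡ P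

  split-step : ∀ {u w p y} {e : u — y} {f : w — y} {P : Path w p} → Split P → Split (step u y e f P)
  split-step {u} {e = e} {f} (split A y′ e′ f′ C eq) = split (step u _ e f A) y′ e′ f′ C (cong (step u _ e f) eq)

  split-after : ∀ {u p} (P : Path u p) {w} → w ∈ xsOf P → w ≢ p → Σ[ s ∈ Split P ] Split.left s ≡ w
  split-after (end u) (here refl) w≢p = contradiction refl w≢p
  split-after (step u y e f P) (here refl) _ = split (end u) y e f P refl , refl
  split-after (step u y e f P) (there w∈) w≢p = let (s , eq) = split-after P w∈ w≢p in split-step s , eq

  split-at : ∀ {u p} (P : Path u p) {y} → y ∈ ysOf P → Σ[ s ∈ Split P ] Split.y s ≡ y
  split-at (step u y e f P) (here refl) = split (end u) y e f P refl , refl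
  split-at (step u y e f P) (there y∈) = let (s , eq) = split-at P y∈ in split-step s , eq

  -- The cycle is cut at y instead of y₀. Hence any of its X-vertices may be taken as the last one,
  -- and any of its Y-vertices as y₀.
  rotate : ∀ {x LS} (N : Near x LS) → Split (Near.path N) → Near x LS
  rotate {x} {LS} (near P y₀ u— p— covers) (split A y e f C joined) =
    toNear (⟪ C ⟫ ⟨ y₀ , p— , u— ⟩ ⟪ A ⟫) y f e (≈-trans
      (solve 5 (λ x y y₀ a c → (x ⊕ (y ⊕ (c ⊕ (y₀ ⊕ a)))) ⊜ (x ⊕ (y₀ ⊕ (a ⊕ (y ⊕ c))))) ≈-refl
        (ιˣ x) (ιʸ y) (ιʸ y₀) (bag A) (bag C))
      (≈-trans (∙-congˡ {ιˣ x} (∙-congˡ {ιʸ y₀} (≈-sym (bag-join A y e f C))))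
        (subst (λ P → ιˣ x ∙ (ιʸ y₀ ∙ bag P) ≈ LS) (sym joined) covers)))

  rotate-to-last : ∀ {x LS} (N : Near x LS) {w} → w ∈ xsOf (Near.path N) →
    Σ[ N′ ∈ Near x LS ] Near.last N′ ≡ w
  rotate-to-last N {w} w∈ with w Fin.≟ Near.last N
  ... | yes refl = N , refl
  ... | no w≢p = let (s , eq) = split-after (Near.path N) w∈ w≢p in rotate N s , eq

  rotate-to-closing : ∀ {x LS} (N : Near x LS) {y} → y ∈ Near.y₀ N ∷ ysOf (Near.path N) →
    Σ[ N′ ∈ Near x LS ] Near.y₀ N′ ≡ y
  rotate-to-closing N (here refl) = N , refl
  rotate-to-closing N (there y∈) = let (s , eq) = split-at (Near.path N) y∈ in rotate N s , eq

  -- Exits and Fresh are all that the argument takes from the 2-connected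
  -- subgraphs: deleting any one vertex r leaves a path of length two from x to
  -- another vertex of L, and Y-sets smaller than L miss a vertex b joined to L twice.
  Exits : List X → Set
  Exits L = ∀ (r : Vertex) {x t} → x ∈ L → t ∈ L → x ≢ t → r ≢ inj₁ x → r ≢ inj₁ t →
    ∃[ y ] ∃[ w ] x — y × w — y × w ∈ L × w ≢ x × r ≢ inj₂ y × r ≢ inj₁ w

  Fresh : List X → Set
  Fresh L = ∀ S → suc (length S) ≤ length L →
    ∃[ b ] ∃[ v ] ∃[ w ] b ∉ S × v ∈ L × w ∈ L × v ≢ w × v — b × w — b

  -- The inductive step: refuting a cycle that misses one vertex of L.

  module Step (L : List X) (uL : Unique L) (k : ℕ) (|L| : length L ≡ suc k) (2≤k : 2 ≤ k)
    {δ} (k<δ : suc k ≤ δ) (m≤ : m + 5 ≤ 3 * δ) (δ≤ : ∀ v → δ ≤ degree v)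
    (noHam : ∀ {u v S} → Unique S → Seg u v (L , S) → Apart S u v) where

    length-S : ∀ {u v S} → Seg u v (L , S) → length S ≡ k
    length-S {S = S} (P , p) = suc-injective (begin
      suc (length S)        ≡⟨ cong suc (↭-length (proj₂ p)) ⟨
      suc (length (ysOf P)) ≡⟨ length-bag P ⟨
      length (xsOf P)       ≡⟨ ↭-length (proj₁ p) ⟩
      length L              ≡⟨ |L| ⟩
      suc k                 ∎)
      where open ≡-Reasoning

    near-length-S : ∀ {x S} → Near x (L , S) → length S ≡ k
    near-length-S {S = S} (near P y₀ _ _ covers) = suc-injective (begin
      suc (length S)              ≡⟨ cong suc (↭-length (proj₂ covers)) ⟨
      suc (suc (length (ysOf P))) ≡⟨ cong suc (length-bag P) ⟨
      suc (length (xsOf P))       ≡⟨ ↭-length (proj₁ covers) ⟩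
      length L                    ≡⟨ |L| ⟩
      suc k                       ∎)
      where open ≡-Reasoning

    packed : ∀ {S vs} → Unique S → length S ≡ k → AllPairs (λ v w → Seg v w (L , S)) vs →
      length vs * δ + k ≤ m + sum (map (λ v → deg v S) vs)
    packed uS |S| paths = subst (λ t → _ + t ≤ _) |S| (packing δ≤ uS (AllPairs.map (noHam uS) paths))

    module _ {d} (best : ∀ {x S} → Unique S → Near x (L , S) → deg x S ≤ d) where

      -- Leaving out a pivot gives a `Near`, so `best` bounds its degree. Without pivots only the
      -- two ends could be packed, too few to use `m + 5 ≤ 3 * δ`; hence the separate case `μ ≡ 0`.
      pivot-bound : ∀ {a z S} → Unique S → Seg a z (L , S) →
        ∃[ μ ] deg a S + deg z S ≤ μ + suc k × (μ ≡ 0 ⊎ μ * k + 3 ≤ k + μ * d)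
      pivot-bound {a} {z} {S} uS σ@(P , covers) = length ps ,
        subst (λ t → _ ≤ length ps + suc t) (length-S σ) (degree-sum P covers) ,
        bound ps (degree-sum P covers) (pivot-paths P covers) (All.map (best uS) (pivot-near P covers))
        where
        ps = pivots P covers
        bound : ∀ ps → deg a S + deg z S ≤ length ps + suc (length S) →
          AllPairs (λ v w → Seg v w (L , S)) (a ∷ z ∷ ps) → All (λ w → deg w S ≤ d) ps →
          length ps ≡ 0 ⊎ length ps * k + 3 ≤ k + length ps * d
        bound [] _ _ _ = inj₁ refl
        bound ps@(_ ∷ qs) az paths degs = inj₂ (pivots-bound {d = d} (length qs)
          (≤-trans (packed uS (length-S σ) paths) (≤-reflexive (cong (m +_) (sym (+-assoc (deg a S) (deg z S) (sum (map (λ v → deg v S) ps)))))))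
          (subst (λ t → deg a S + deg z S ≤ length ps + suc t) (length-S σ) az)
          (sum-map-≤ _ degs) m≤ k<δ)

      -- A pivot would be a left-out vertex with two neighbours in `S`, against `best`.
      no-pivots : d ≤ 1 → ∀ {a z S} → Unique S → Seg a z (L , S) → deg a S + deg z S ≤ suc k
      no-pivots d≤1 uS σ@(P , covers)
        with pivots P covers | degree-sum P covers | pivot-near P covers | pivot-degree P covers
      ... | [] | h | _ | _ = subst (λ t → _ ≤ suc t) (length-S σ) h
      ... | _ ∷ _ | _ | N ∷ _ | 2≤ ∷ _ = contradiction (≤-trans 2≤ (≤-trans (best uS N) d≤1)) λ { (s≤s ()) }

      module _ {x S} (uS : Unique S) (N : Near x (L , S)) (degx : deg x S ≡ d) where
        open Near N

        private
          |S| = near-length-S N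
          vs  = successors path first— last— covers

          all≤k : ∀ vs → sum (map (λ v → deg v S) vs) ≤ length vs * k
          all≤k vs = sum-map-≤ (λ v → deg v S) (All.tabulate {xs = vs} λ {v} _ →
            ≤-trans (length-filter (v —?_) S) (≤-reflexive |S|))

        degree-sum-successors : ∀ {e} → d ≡ 2 + e → length vs ≡ d × d * k + 3 ≤ sum (map (λ v → deg v S) vs) + k
        degree-sum-successors {e} refl = |vs| , successors-bound e
          (≤-trans (≤-reflexive (cong (λ t → suc t * δ + k) (sym |vs|)))
          (≤-trans (packed uS |S| (successors-paths path first— last— covers))
            (≤-reflexive (cong (λ t → m + (t + sum (map (λ v → deg v S) vs))) degx)))) m≤ k<δ
          where |vs| = trans (length-successors path first— last— covers) degx

        -- Successors have degree at most k, so by `degree-sum-successors` two of them sum to at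
        -- least `k + 3`; this takes two pivots and forces `4 ≤ d`. So there are four successors,
        -- whose sum of at least `3 * k + 3` contradicts `pair-small` on v₁, v₂ and on v₃, v₄.
        no-middle : ∀ {e g} → d ≡ 2 + e → k ≡ 2 + d + g → ⊥
        no-middle {e} {g} d≡ k≡
          with vs | successors-paths path first— last— covers | degree-sum-successors d≡
        ... | [] | _ | refl , _ = contradiction d≡ λ ()
        ... | _ ∷ [] | _ | refl , _ = contradiction d≡ λ ()
        ... | v₁ ∷ v₂ ∷ ws | _ ∷ (s₁₂ ∷ _) ∷ rest | |vs| , h = large ws rest |vs| h
          where
          b₁₂ = pivot-bound uS s₁₂
          small₁₂ = pair-small (proj₁ b₁₂) k≡ (subst (2 ≤_) (sym d≡) (m≤m+n 2 e)) (proj₁ (proj₂ b₁₂)) (proj₂ (proj₂ b₁₂))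
          large : ∀ ws → AllPairs (λ v w → Seg v w (L , S)) (v₂ ∷ ws) → 2 + length ws ≡ d →
            d * k + 3 ≤ deg v₁ S + (deg v₂ S + sum (map (λ v → deg v S) ws)) + k → ⊥
          large ws rest |vs| h = larger ws rest |vs| h (4≤degree (proj₁ b₁₂) k≡
            (two-large (length ws) {deg v₁ S} {deg v₂ S} (subst (λ t → t * k + 3 ≤ _) (sym |vs|) h) (all≤k ws))
            (proj₁ (proj₂ b₁₂)) (proj₂ (proj₂ b₁₂)))
            where
            larger : ∀ ws → AllPairs (λ v w → Seg v w (L , S)) (v₂ ∷ ws) → 2 + length ws ≡ d →
              d * k + 3 ≤ deg v₁ S + (deg v₂ S + sum (map (λ v → deg v S) ws)) + k → 4 ≤ d → ⊥
            larger [] _ refl _ (s≤s (s≤s ()))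
            larger (_ ∷ []) _ refl _ (s≤s (s≤s (s≤s ())))
            larger (v₃ ∷ v₄ ∷ us) (_ ∷ (s₃₄ ∷ _) ∷ _) refl h _ = four-small (length us) {deg v₁ S} {deg v₂ S} {deg v₃ S} {deg v₄ S} h (all≤k us) small₁₂
              (let (μ , b , c) = pivot-bound uS s₃₄ in pair-small μ k≡ (m≤m+n 2 _) b c)

    -- Left-out vertices adjacent to almost the whole cycle.

    -- By `tail-paths`, x and the vertices of P after u are pairwise apart, so of two neighbours of
    -- c one is u; on the reversed path, one is p. A third neighbour together with p would break the
    -- first claim.
    shared-by-ends : ∀ {x S u p} (P : Path u p) {y₀} (u— : u — y₀) (p— : p — y₀)
      (covers : ιˣ x ∙ (ιʸ y₀ ∙ bag P) ≈ (L , S)) → Unique S → u ≢ p → All (x —_) (ysOf P) →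
      ∀ {c v w} → c ∉ S → v ∈ L → w ∈ L → v ≢ w → v — c → w — c →
      u — c × p — c × (∀ {t} → t ∈ L → t — c → t ≡ u ⊎ t ≡ p)
    shared-by-ends {x} {S} {u} {p} P {y₀} u— p— covers uS u≢p x— {c} {v} {w} c∉S v∈ w∈ v≢w v— w— =
      adjacent (one-is-first v∈ w∈ v≢w v— w—) ,
      adjacent (one-is-last v∈ w∈ v≢w v— w—) ,
      only
      where
      Q = proj₁ (reverse P)
      covers′ : ιˣ x ∙ (ιʸ y₀ ∙ bag Q) ≈ (L , S)
      covers′ = ≈-trans (∙-congˡ {ιˣ x} (∙-congˡ {ιʸ y₀} (proj₂ (reverse P)))) covers
      one-is : ∀ {u p} (P : Path u p) (u— : u — y₀) (p— : p — y₀)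
        (covers : ιˣ x ∙ (ιʸ y₀ ∙ bag P) ≈ (L , S)) → All (x —_) (ysOf P) →
        ∀ {v w} → v ∈ L → w ∈ L → v ≢ w → v — c → w — c → v ≡ u ⊎ w ≡ u
      one-is {u} P u— p— covers x— {v} {w} v∈ w∈ v≢w v— w— with v Fin.≟ u | w Fin.≟ u
      ... | yes v≡u | _ = inj₁ v≡u
      ... | no _ | yes w≡u = inj₂ w≡u
      ... | no v≢u | no w≢u = ⊥-elim (AllPairs-lookup {R = Apart S} (λ ap c∉ a— b— → ap c∉ b— a—)
            (AllPairs.map (noHam uS) (tail-paths P u— p— covers x—))
            (located v∈ v≢u) (located w∈ w≢u) v≢w c∉S v— w—)
        where
        located : ∀ {t} → t ∈ L → t ≢ u → t ∈ x ∷ map proj₁ (links P)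
        located t∈ t≢u with subst (λ xs → _ ∈ x ∷ xs) (sym (links-xs P)) (∈-resp-↭ (↭-sym (proj₁ covers)) t∈)
        ... | here t≡x = here t≡x
        ... | there (here t≡u) = contradiction t≡u t≢u
        ... | there (there t∈) = there t∈
      one-is-first : ∀ {v w} → v ∈ L → w ∈ L → v ≢ w → v — c → w — c → v ≡ u ⊎ w ≡ u
      one-is-first = one-is P u— p— covers x—
      one-is-last : ∀ {v w} → v ∈ L → w ∈ L → v ≢ w → v — c → w — c → v ≡ p ⊎ w ≡ p
      one-is-last = one-is Q p— u— covers′ (All.tabulate λ y∈ →
        All.lookup x— (∈-resp-↭ (proj₂ (proj₂ (reverse P))) y∈))
      adjacent : ∀ {t} → v ≡ t ⊎ w ≡ t → t — c
      adjacent (inj₁ refl) = v—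
      adjacent (inj₂ refl) = w—
      p∈L : p ∈ L
      p∈L = ∈-resp-↭ (proj₁ covers) (there (last∈ P))
      only : ∀ {t} → t ∈ L → t — c → t ≡ u ⊎ t ≡ p
      only {t} t∈ t— with t Fin.≟ p
      ... | yes t≡p = inj₂ t≡p
      ... | no t≢p with one-is-first t∈ p∈L t≢p t— (adjacent (one-is-last v∈ w∈ v≢w v— w—))
      ...   | inj₁ t≡u = inj₁ t≡u
      ...   | inj₂ p≡u = contradiction (sym p≡u) u≢p

    first≢last : ∀ {u p} (P : Path u p) → Unique (xsOf P) → 1 ≤ length (ysOf P) → u ≢ p
    first≢last (step u y e f P) (u∉ ∷ _) _ refl = All.lookup u∉ (last∈ P) refl

    all-open-adjacent : ∀ {x S} (N : Near x (L , S)) → k ≤ suc (deg x S) → ¬ x — Near.y₀ N →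
      All (x —_) (ysOf (Near.path N))
    all-open-adjacent {x} {S} N@(near P y₀ _ _ covers) k≤ ¬x— = count-full (x —?_) (ysOf P) (s≤s⁻¹ (begin
      suc (length (ysOf P))        ≡⟨ ↭-length (proj₂ covers) ⟩
      length S                     ≡⟨ near-length-S N ⟩
      k                            ≤⟨ k≤ ⟩
      suc (deg x S)                ≡⟨ cong suc (count-resp-↭ (x —?_) (proj₂ covers)) ⟨
      suc (deg x (y₀ ∷ ysOf P))    ≡⟨ cong suc (count-no (x —?_) (ysOf P) ¬x—) ⟩
      suc (deg x (ysOf P))         ∎))
      where open ≤-Reasoning

    -- Since x misses at most one Y-vertex of the cycle, a missed one is rotated to y₀, and the open
    -- path has none left.
    full-rotation : ∀ {x S} (N : Near x (L , S)) → k ≤ suc (deg x S) →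
      Σ[ N′ ∈ Near x (L , S) ] All (x —_) (ysOf (Near.path N′))
    full-rotation {x} N k≤ with All.all? (x —?_) (ysOf (Near.path N))
    ... | yes all = N , all
    ... | no ¬all with find (All.¬All⇒Any¬ (x —?_) _ ¬all)
    ...   | y , y∈ , ¬x—y with rotate-to-closing N (there y∈)
    ...     | N′ , refl = N′ , all-open-adjacent N′ k≤ ¬x—y

    -- Once b has replaced y₀, `shared-by-ends` applies to y₀ as well: no vertex of L but u and p is
    -- adjacent to it. This makes the degrees of x and of the vertices after u too small for their
    -- packing.
    no-almost-full : Fresh L → ∀ {x S} → Unique S → Near x (L , S) → k ≤ suc (deg x S) → 2 ≤ deg x S → ⊥
    no-almost-full fresh {x} {S} uS N k≤ 2≤d with full-rotation N k≤
    ... | N′@(near {u} {p} P y₀ u— p— covers) , x— = bound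
      where
      unique-xs : Unique (x ∷ xsOf P)
      unique-xs = Unique-resp-↭ (↭-sym (proj₁ covers)) uL
      unique-ys : Unique (y₀ ∷ ysOf P)
      unique-ys = Unique-resp-↭ (↭-sym (proj₂ covers)) uS
      |y₀∷ys| : suc (length (ysOf P)) ≡ k
      |y₀∷ys| = trans (↭-length (proj₂ covers)) (near-length-S N)
      u≢p : u ≢ p
      u≢p = first≢last P (AllPairs.tail unique-xs) (s≤s⁻¹ (subst (2 ≤_) (sym |y₀∷ys|) 2≤k))
      uv = shared-by-ends P u— p— covers uS u≢p x—
      b = proj₁ (fresh S (≤-reflexive (trans (cong suc (near-length-S N)) (sym |L|))))
      -- By its two neighbours in L, b can take the place of y₀ on the cycle.
      b-facts : b ∉ S × u — b × p — b
      b-facts with fresh S (≤-reflexive (trans (cong suc (near-length-S N)) (sym |L|)))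
      ... | _ , _ , _ , b∉S , v∈ , w∈ , v≢w , v— , w— = b∉S , proj₁ r , proj₁ (proj₂ r)
        where r = uv b∉S v∈ w∈ v≢w v— w—
      b∉ys : b ∉ ysOf P
      b∉ys b∈ = proj₁ b-facts (∈-resp-↭ (proj₂ covers) (there b∈))
      b≢y₀ : b ≢ y₀
      b≢y₀ refl = proj₁ b-facts (∈-resp-↭ (proj₂ covers) (here refl))
      y₀∉ : y₀ ∉ b ∷ ysOf P
      y₀∉ (here y₀≡b) = b≢y₀ (sym y₀≡b)
      y₀∉ (there y₀∈) = All.lookup (AllPairs.head unique-ys) y₀∈ refl
      in-L : ∀ {t} → t ∈ x ∷ xsOf P → t ∈ L
      in-L = ∈-resp-↭ (proj₁ covers)
      y₀-neighbours : ∀ {t} → t ∈ L → t — y₀ → t ≡ u ⊎ t ≡ p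
      -- The cycle now has Y-part `b ∷ ysOf P`, and y₀ plays the part of the outside vertex c.
      y₀-neighbours = proj₂ (proj₂ (shared-by-ends P {b} (proj₁ (proj₂ b-facts)) (proj₂ (proj₂ b-facts))
        (proj₁ covers , ↭-refl) (All.¬Any⇒All¬ _ b∉ys ∷ AllPairs.tail unique-ys) u≢p x—
        y₀∉ (in-L (there (first∈ P))) (in-L (there (last∈ P))) u≢p u— p—))
      ¬x—y₀ : ¬ x — y₀
      ¬x—y₀ x—y₀ with y₀-neighbours (in-L (here refl)) x—y₀
      ... | inj₁ refl = All.lookup (AllPairs.head unique-xs) (first∈ P) refl
      ... | inj₂ refl = All.lookup (AllPairs.head unique-xs) (last∈ P) refl
      vs = map proj₁ (links P)
      unique-vs : Unique (u ∷ vs)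
      unique-vs = subst Unique (sym (links-xs P)) (AllPairs.tail unique-xs)
      ys-bound : ∀ v → deg v (ysOf P) ≤ length (ysOf P)
      ys-bound v = length-filter (v —?_) (ysOf P)
      touching : List X → ℕ
      touching = count (_—? y₀)
      regroup : ∀ a b c d → (a + b) + (c + d) ≡ (a + c) + (b + d)
      regroup = solve-∀
      total : ∀ vs → sum (map (λ v → deg v S) vs) ≤ touching vs + length vs * length (ysOf P)
      total [] = z≤n
      total (v ∷ vs) = begin
        deg v S + sum (map (λ v → deg v S) vs)
          ≡⟨ cong (_+ _) (trans (sym (count-resp-↭ (v —?_) (proj₂ covers))) (count-∷ (v —?_) y₀ (ysOf P))) ⟩
        indicator (v —? y₀) + deg v (ysOf P) + sum (map (λ v → deg v S) vs)
          ≤⟨ +-mono-≤ (+-monoʳ-≤ (indicator (v —? y₀)) (ys-bound v)) (total vs) ⟩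
        indicator (v —? y₀) + length (ysOf P) + (touching vs + length vs * length (ysOf P))
          ≡⟨ regroup (indicator (v —? y₀)) _ (touching vs) _ ⟩
        indicator (v —? y₀) + touching vs + (length (ysOf P) + length vs * length (ysOf P))
          ≡⟨ cong (_+ suc (length vs) * length (ysOf P)) (count-∷ (_—? y₀) v vs) ⟨
        touching (v ∷ vs) + suc (length vs) * length (ysOf P) ∎
        where open ≤-Reasoning
      -- Only u and p can be adjacent to y₀, and u does not occur in `vs`.
      touching≤1 : touching vs ≤ 1
      touching≤1 = ⊆-length {ys = p ∷ []} (Unique.filter⁺ (_—? y₀) (AllPairs.tail unique-vs)) only-p
        where
        only-p : filter (_—? y₀) vs ⊆ p ∷ []
        only-p t∈ with ∈-filter⁻ (_—? y₀) {xs = vs} t∈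
        ... | t∈vs , t— with y₀-neighbours (in-L (there (subst (_ ∈_) (links-xs P) (there t∈vs)))) t—
        ...   | inj₁ refl = contradiction refl (All.lookup (AllPairs.head unique-vs) t∈vs)
        ...   | inj₂ t≡p = here t≡p
      |vs| : length vs ≡ length (ysOf P)
      |vs| = suc-injective (trans (cong length (links-xs P)) (length-bag P))
      dx≤ : deg x S ≤ length (ysOf P)
      dx≤ = ≤-trans (≤-reflexive (trans (sym (count-resp-↭ (x —?_) (proj₂ covers)))
        (count-no (x —?_) (ysOf P) ¬x—y₀))) (ys-bound x)
      arithmetic : ∀ e → length vs ≡ e → length (ysOf P) ≡ e → 2 ≤ e → suc e ≡ k → ⊥
      arithmetic (suc (suc g)) |vs| |ys| _ refl = tail-bound {Σ = sum (map (λ v → deg v S) vs)} g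
        (subst (λ t → suc t * δ + k ≤ m + (deg x S + sum (map (λ v → deg v S) vs))) |vs| (packed uS (near-length-S N) (tail-paths P u— p— covers x—)))
        (subst (deg x S ≤_) |ys| dx≤)
        (≤-trans (total vs) (+-mono-≤ touching≤1 (≤-reflexive (cong₂ _*_ |vs| |ys|)))) m≤ k<δ
      arithmetic (suc zero) _ _ (s≤s ()) _
      bound : ⊥
      bound = arithmetic _ |vs| refl (≤-trans 2≤d dx≤) |y₀∷ys|

    -- Left-out vertices with at most one neighbour on the cycle.

    module _ (few : ∀ {u v S} → Unique S → Seg u v (L , S) → deg u S + deg v S ≤ suc k) where

      -- x leaves the cycle by y′ to p and by y″ to w. Threading x in through both
      -- gives a path from u to v avoiding h, and x, u, v are then pairwise apart.
      no-two-exits : ∀ {x S u w v p} (Q : Path u w) {h} (w—h : w — h) (v—h : v — h) (C : Path v p)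
        {g} (u—g : u — g) (p—g : p — g) → ιʸ g ∙ (ιʸ h ∙ (ιˣ x ∙ (bag Q ∙ bag C))) ≈ (L , S) →
        Unique S → (∀ {y} → y ∈ h ∷ ysOf Q ++ ysOf C → ¬ x — y) →
        ∀ {y′ y″} → x — y′ → p — y′ → x — y″ → w — y″ → y″ ∉ S → y′ ≢ y″ → (x — g → g ≡ y′) → ⊥
      no-two-exits {x} {S} {u} {w} {v} {p} Q {h} w—h v—h C {g} u—g p—g covers uS clean {y′} {y″}
        x—y′ p—y′ x—y″ w—y″ y″∉S y′≢y″ x—g⇒ =
        three-apart-bound {δ = δ} {x = deg x S′} {deg u S′} {deg v S′}
          (subst (λ t → 3 * δ + t ≤ m + (deg x S′ + (deg u S′ + (deg v S′ + 0)))) (length-S path-uv)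
            (packing δ≤ uS′ ((apart-xu ∷ apart-xv ∷ []) ∷ (noHam uS′ path-uv ∷ []) ∷ [] ∷ [])))
          dx≤2 (few uS′ path-uv) m≤
        where
        R = ysOf Q ++ ysOf C
        S′ = y′ ∷ y″ ∷ R
        unique-S : Unique (g ∷ h ∷ R)
        unique-S = Unique-resp-↭ (↭-sym (proj₂ covers)) uS
        uR : Unique R
        uR = AllPairs.tail (AllPairs.tail unique-S)
        _∷ᵘ_ : ∀ {y ys} → y ∉ ys → Unique ys → Unique (y ∷ ys)
        y∉ ∷ᵘ u = All.¬Any⇒All¬ _ y∉ ∷ u
        y′∉ : y′ ∉ h ∷ R
        y′∉ y∈ = clean y∈ x—y′
        y″∉ : y″ ∉ g ∷ h ∷ R
        y″∉ y∈ = y″∉S (∈-resp-↭ (proj₂ covers) y∈)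
        uS′ : Unique S′
        uS′ = (λ { (here y′≡y″) → y′≢y″ y′≡y″ ; (there y∈) → y′∉ (there y∈) }) ∷ᵘ
          ((λ y∈ → y″∉ (there (there y∈))) ∷ᵘ uR)
        with-ys : ∀ {α y z} → α ≈ ιʸ y ∙ (ιʸ z ∙ (ιˣ x ∙ (bag Q ∙ bag C))) → α ≈ (L , y ∷ z ∷ R)
        with-ys (xs↭ , ys↭) = ↭-trans xs↭ (proj₁ covers) , ys↭
        path-uv : Seg u v (L , S′)
        path-uv = rebag (with-ys (solve 5 (λ x y z q c → (q ⊕ (z ⊕ (x ⊕ (y ⊕ c)))) ⊜ (y ⊕ (z ⊕ (x ⊕ (q ⊕ c)))))
            ≈-refl (ιˣ x) (ιʸ y′) (ιʸ y″) (bag Q) (bag C)))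
          (⟪ Q ⟫ ⟨ y″ , w—y″ , x—y″ ⟩ ⟪ end x ⟫ ⟨ y′ , x—y′ , p—y′ ⟩ reverse C)
        -- The path from x to u has h in place of y″; c is not h either, since x misses h.
        apart-xu : Apart S′ x u
        apart-xu {c} c∉ x—c u—c = noHam (y′∉ ∷ᵘ AllPairs.tail unique-S)
          (rebag (with-ys (solve 5 (λ x y z q c → (x ⊕ (y ⊕ (c ⊕ (z ⊕ q)))) ⊜ (y ⊕ (z ⊕ (x ⊕ (q ⊕ c)))))
            ≈-refl (ιˣ x) (ιʸ y′) (ιʸ h) (bag Q) (bag C)))
          (⟪ end x ⟫ ⟨ y′ , x—y′ , p—y′ ⟩ reverse C ⟨ h , v—h , w—h ⟩ reverse Q))
          (λ { (here refl) → c∉ (here refl) ; (there (here refl)) → clean (here refl) x—c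
             ; (there (there c∈)) → c∉ (there (there c∈)) }) x—c u—c
        -- The path from x to v has g in place of y′. If c were g, then x would be adjacent to g,
        -- making it y′, which lies in `S′`.
        apart-xv : Apart S′ x v
        apart-xv {c} c∉ x—c v—c = noHam
          ((λ { (here refl) → y″∉ (here refl) ; (there y∈) → y″∉ (there (there y∈)) }) ∷ᵘ
            ((λ g∈ → All.lookup (AllPairs.head unique-S) (there g∈) refl) ∷ᵘ uR))
          (rebag (with-ys (solve 5 (λ x y z q c → (x ⊕ (y ⊕ (q ⊕ (z ⊕ c)))) ⊜ (y ⊕ (z ⊕ (x ⊕ (q ⊕ c)))))
            ≈-refl (ιˣ x) (ιʸ y″) (ιʸ g) (bag Q) (bag C)))
          (⟪ end x ⟫ ⟨ y″ , x—y″ , w—y″ ⟩ reverse Q ⟨ g , u—g , p—g ⟩ reverse C))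
          (λ { (here refl) → c∉ (there (here refl)) ; (there (here refl)) → c∉ (here (x—g⇒ x—c))
             ; (there (there c∈)) → c∉ (there (there c∈)) }) x—c v—c
        dx≤2 : deg x S′ ≤ 2
        dx≤2 = ≤-reflexive (trans (count-yes (x —?_) (y″ ∷ R) x—y′) (cong suc
          (trans (count-yes (x —?_) R x—y″) (cong (suc ∘ length)
            (filter-none (x —?_) (All.tabulate λ y∈ → clean (there y∈)))))))

      cut-covers : ∀ {x S} (N : Near x (L , S)) (s : Split (Near.path N)) →
        ιʸ (Near.y₀ N) ∙ (ιʸ (Split.y s) ∙ (ιˣ x ∙ (bag (Split.before s) ∙ bag (Split.after s)))) ≈ (L , S)
      cut-covers {x} (near _ y₀ _ _ covers) (split A y e f C refl) = ≈-trans
        (solve 5 (λ x y y₀ a c → (y₀ ⊕ (y ⊕ (x ⊕ (a ⊕ c)))) ⊜ (x ⊕ (y₀ ⊕ (a ⊕ (y ⊕ c))))) ≈-refl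
          (ιˣ x) (ιʸ y) (ιʸ y₀) (bag A) (bag C))
        (≈-trans (∙-congˡ {ιˣ x} (∙-congˡ {ιʸ y₀} (≈-sym (bag-join A y e f C)))) covers)

      in-path : ∀ {x S w} (N : Near x (L , S)) → w ∈ L → w ≢ x → w ∈ xsOf (Near.path N)
      in-path N w∈ w≢x with ∈-resp-↭ (↭-sym (proj₁ (Near.covers N))) w∈
      ... | here w≡x = contradiction w≡x w≢x
      ... | there w∈xs = w∈xs

      -- Two exits with different Y-vertices and different ends suffice. Deleting p gives (y, w),
      -- and deleting w gives (y₂, w₂). If y₂ is y, deleting y gives (y₃, w₃), and w₃ differs from w
      -- or from w₂.
      no-isolated : Exits L → ∀ {x S} → Unique S → Near x (L , S) → deg x S ≡ 0 → ⊥
      no-isolated exits {x} {S} uS N@(near {u} {p} P y₀ _ _ covers) d≡0 = by-exits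
        -- Deleting p makes w differ from p, so p can be the target when w is deleted.
        (exits (inj₁ p) x∈L (in-L (first∈ P)) (≢-sym u≢x) (p≢x ∘ inj₁-injective) (≢-sym u≢p ∘ inj₁-injective))
        where
        unique-xs : Unique (x ∷ xsOf P)
        unique-xs = Unique-resp-↭ (↭-sym (proj₁ covers)) uL
        in-L : ∀ {t} → t ∈ xsOf P → t ∈ L
        in-L t∈ = ∈-resp-↭ (proj₁ covers) (there t∈)
        x∈L : x ∈ L
        x∈L = ∈-resp-↭ (proj₁ covers) (here refl)
        u≢x : u ≢ x
        u≢x u≡x = All.lookup (AllPairs.head unique-xs) (first∈ P) (sym u≡x)
        p≢x : p ≢ x
        p≢x p≡x = All.lookup (AllPairs.head unique-xs) (last∈ P) (sym p≡x)
        u≢p : u ≢ p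
        u≢p = first≢last P (AllPairs.tail unique-xs) (s≤s⁻¹ (subst (2 ≤_)
          (sym (trans (↭-length (proj₂ covers)) (near-length-S N))) 2≤k))
        missed : ∀ {y} → y ∈ S → ¬ x — y
        missed = count≡0⇒¬ (x —?_) S d≡0
        finish : ∀ {y′ p′ y″ w′} → y′ ≢ y″ → p′ ≢ w′ → p′ ∈ L → w′ ∈ L → p′ ≢ x → w′ ≢ x →
          x — y′ → p′ — y′ → x — y″ → w′ — y″ → ⊥
        finish y′≢y″ p′≢w′ p′∈ w′∈ p′≢x w′≢x x—y′ p′—y′ x—y″ w′—y″ with rotate-to-last N (in-path N p′∈ p′≢x)
        ... | N′ , refl with split-after (Near.path N′) (in-path N′ w′∈ w′≢x) (≢-sym p′≢w′)
        ...   | s , refl = no-two-exits (Split.before s) (Split.left— s) (Split.right— s) (Split.after s)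
          (Near.first— N′) (Near.last— N′) (cut-covers N′ s) uS
          (λ y∈ → missed (∈-resp-↭ (proj₂ (cut-covers N′ s)) (there y∈)))
          x—y′ p′—y′ x—y″ w′—y″ (λ y″∈ → missed y″∈ x—y″) y′≢y″
          (λ x—g → ⊥-elim (missed (∈-resp-↭ (proj₂ (cut-covers N′ s)) (here refl)) x—g))
        by-exits : ∃[ y ] ∃[ w ] x — y × w — y × w ∈ L × w ≢ x × inj₁ p ≢ inj₂ y × inj₁ p ≢ inj₁ w → ⊥
        by-exits (y , w , x—y , w—y , w∈ , w≢x , _ , p≢w)
          with exits (inj₁ w) x∈L (in-L (last∈ P)) (≢-sym p≢x) (w≢x ∘ inj₁-injective) (≢-sym p≢w)
        ... | y₂ , w₂ , x—y₂ , w₂—y₂ , w₂∈ , w₂≢x , _ , w≢w₂ with y Fin.≟ y₂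
        ...   | no y≢y₂ = finish y≢y₂ (w≢w₂ ∘ cong inj₁) w∈ w₂∈ w≢x w₂≢x x—y w—y x—y₂ w₂—y₂
        ...   | yes refl with exits (inj₂ y) x∈L (in-L (last∈ P)) (≢-sym p≢x) (λ ()) (λ ())
        ...     | y₃ , w₃ , x—y₃ , w₃—y₃ , w₃∈ , w₃≢x , y≢y₃ , _ with w Fin.≟ w₃
        ...       | no w≢w₃ = finish (y≢y₃ ∘ cong inj₂) w≢w₃ w∈ w₃∈ w≢x w₃≢x x—y w—y x—y₃ w₃—y₃
        ...       | yes refl = finish (y≢y₃ ∘ cong inj₂) (≢-sym w≢w₂ ∘ cong inj₁) w₂∈ w∈ w₂≢x w≢x x—y w₂—y₂ x—y₃ w₃—y₃

      -- The one neighbour of x on the cycle, rotated to y₀, is the exit to p, so y′ and g coincide;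
      -- deleting it gives the other exit.
      no-pendant : Exits L → ∀ {x S} → Unique S → Near x (L , S) → deg x S ≡ 1 → ⊥
      no-pendant exits {x} {S} uS N d≡1 with filter (x —?_) S in eq
      ... | y ∷ _ with ∈-filter⁻ (x —?_) {xs = S} (subst (y ∈_) (sym eq) (here refl))
      ...   | y∈S , x—y with rotate-to-closing N (∈-resp-↭ (↭-sym (proj₂ (Near.covers N))) y∈S)
      ...     | N′@(near {u} {p} P y₀ u— p— covers) , refl = by-exit
        (exits (inj₂ y₀) x∈L (∈-resp-↭ (proj₁ covers) (there (first∈ P))) x≢u (λ ()) (λ ()))
        where
        x∈L : x ∈ L
        x∈L = ∈-resp-↭ (proj₁ covers) (here refl)
        x≢u : x ≢ u
        x≢u = All.lookup (AllPairs.head (Unique-resp-↭ (↭-sym (proj₁ covers)) uL)) (first∈ P)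
        missed : ∀ {y} → y ∈ ysOf P → ¬ x — y
        missed = count≡0⇒¬ (x —?_) (ysOf P) (suc-injective (trans (sym (count-yes (x —?_) (ysOf P) x—y))
          (trans (count-resp-↭ (x —?_) (proj₂ covers)) (trans (cong length eq) d≡1))))
        by-exit : ∃[ y ] ∃[ w ] x — y × w — y × w ∈ L × w ≢ x × inj₂ y₀ ≢ inj₂ y × inj₂ y₀ ≢ inj₁ w → ⊥
        by-exit (y″ , w , x—y″ , w—y″ , w∈ , w≢x , y₀≢y″ , _) = through (split-after P (in-path N′ w∈ w≢x) w≢p)
          where
          y″∉S : y″ ∉ S
          y″∉S y″∈ with ∈-resp-↭ (↭-sym (proj₂ covers)) y″∈
          ... | here refl = y₀≢y″ refl
          ... | there y″∈ys = missed y″∈ys x—y″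
          -- Otherwise y″ would close the path from x over y₀ through P to a cycle through L.
          w≢p : w ≢ p
          w≢p refl = noHam uS (rebag covers (⟪ end x ⟫ ⟨ y₀ , x—y , u— ⟩ ⟪ P ⟫)) y″∉S x—y″ w—y″
          through : Σ[ s ∈ Split P ] Split.left s ≡ w → ⊥
          through (split A h e f C refl , refl) = no-two-exits A e f C u— p— (cut-covers N′ (split A h e f C refl)) uS
            (λ y∈ → missed (∈-resp-↭ (↭-trans (↭-sym (shift h (ysOf A) (ysOf C))) (proj₂ (≈-sym (bag-join A h e f C)))) y∈))
            x—y p— x—y″ w—y″ y″∉S (y₀≢y″ ∘ cong inj₂) (λ _ → refl)

    -- Choosing the left-out vertex and cycle of maximal degree.

    module _ (exits : Exits L) (fresh : Fresh L) where

      no-best : ∀ {x S} → Unique S → Near x (L , S) →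
        (∀ {x′ S′} → Unique S′ → Near x′ (L , S′) → deg x′ S′ ≤ deg x S) → ⊥
      no-best {x} {S} uS N best = by-degree (deg x S) refl
        where
        by-degree : ∀ d → deg x S ≡ d → ⊥
        by-degree 0 d≡ = no-isolated (no-pivots best (≤-trans (≤-reflexive d≡) z≤n)) exits uS N d≡
        by-degree 1 d≡ = no-pendant (no-pivots best (≤-reflexive d≡)) exits uS N d≡
        by-degree d@(suc (suc e)) d≡ with k ≤? suc d
        ... | yes k≤ = no-almost-full fresh uS N (≤-trans k≤ (≤-reflexive (cong suc (sym d≡))))
          (≤-trans (s≤s (s≤s z≤n)) (≤-reflexive (sym d≡)))
        ... | no k≰ = no-middle best uS N refl {e} {k ∸ (2 + deg x S)} d≡
          (sym (m+[n∸m]≡n (≤-trans (≤-reflexive (cong (2 +_) d≡)) (≰⇒> k≰))))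

      -- The degree never exceeds `k`, and `f` bounds how much it can still grow. Each passage to a
      -- larger degree lowers `f`, so a maximum is reached.
      no-near : ∀ f {x S} → Unique S → Near x (L , S) → k ≤ f + deg x S → ⊥
      no-near f {x} {S} uS N k≤ = no-best uS N (larger f k≤)
        where
        larger : ∀ f → k ≤ f + deg x S → ∀ {x′ S′} → Unique S′ → Near x′ (L , S′) → deg x′ S′ ≤ deg x S
        larger zero k≤ {x′} {S′} _ N′ = ≤-trans (length-filter (x′ —?_) S′)
          (≤-trans (≤-reflexive (near-length-S N′)) k≤)
        larger (suc f) k≤ {x′} {S′} uS′ N′ with deg x′ S′ ≤? deg x S
        ... | yes le = le
        ... | no nle = ⊥-elim (no-near f uS′ N′ (≤-trans k≤ (≤-trans (≤-reflexive (sym (+-suc f _)))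
          (+-monoʳ-≤ f (≰⇒> nle)))))

  -- Cycles as vertex lists, and their search.

  verts : ∀ {u v} → Path u v → List Vertex
  verts (end u) = inj₁ u ∷ []
  verts (step u y _ _ P) = inj₁ u ∷ inj₂ y ∷ verts P

  length-verts : ∀ {u v} (P : Path u v) → length (verts P) ≡ length (xsOf P) + length (ysOf P)
  length-verts (end _) = refl
  length-verts (step _ _ _ _ P) = cong suc (trans (cong suc (length-verts P)) (sym (+-suc _ _)))

  ∈-xs : ∀ {u v x} (P : Path u v) → inj₁ x ∈ verts P → x ∈ xsOf P
  ∈-xs (end _) (here refl) = here refl
  ∈-xs (step _ _ _ _ P) (here refl) = here refl
  ∈-xs (step _ _ _ _ P) (there (there x∈)) = there (∈-xs P x∈)

  xs-∈ : ∀ {u v x} (P : Path u v) → x ∈ xsOf P → inj₁ x ∈ verts P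
  xs-∈ (end _) (here refl) = here refl
  xs-∈ (step _ _ _ _ P) (here refl) = here refl
  xs-∈ (step _ _ _ _ P) (there x∈) = there (there (xs-∈ P x∈))

  ∈-ys : ∀ {u v y} (P : Path u v) → inj₂ y ∈ verts P → y ∈ ysOf P
  ∈-ys (step _ _ _ _ P) (there (here refl)) = here refl
  ∈-ys (step _ _ _ _ P) (there (there y∈)) = there (∈-ys P y∈)
  ∈-ys (end _) (there ())

  unique-verts : ∀ {u v} (P : Path u v) → Unique (xsOf P) → Unique (ysOf P) → Unique (verts P)
  unique-verts (end _) _ _ = [] ∷ []
  unique-verts (step u y _ _ P) (u∉ ∷ uxs) (y∉ ∷ uys) =
    ((λ ()) ∷ All.¬Any⇒All¬ _ λ u∈ → All.lookup u∉ (∈-xs P u∈) refl) ∷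
    (All.¬Any⇒All¬ _ λ y∈ → All.lookup y∉ (∈-ys P y∈) refl) ∷ unique-verts P uxs uys

  linked-verts : ∀ {u v c} (P : Path u v) → v — c → Linked Adjacent (verts P ∷ʳ inj₂ c)
  linked-verts (end _) v—c = v—c ∷ [-]
  linked-verts (step u y e f P@(end _)) v—c = e ∷ f ∷ linked-verts P v—c
  linked-verts (step u y e f P@(step _ _ _ _ _)) v—c = e ∷ f ∷ linked-verts P v—c

  linked-cycle : ∀ {u v c} (P : Path u v) → u — c → v — c → Linked Adjacent (inj₂ c ∷ verts P ∷ʳ inj₂ c)
  linked-cycle P@(end _) u—c v—c = u—c ∷ linked-verts P v—c
  linked-cycle P@(step _ _ _ _ _) u—c v—c = u—c ∷ linked-verts P v—c

  -- `Cycle` and `MeetsXIn` on a bare vertex list, with the equivalence split into implications so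
  -- that every conjunct is decidable.
  IsCycleOn : Subset n → List Vertex → Set
  IsCycleOn X′ [] = ⊥
  IsCycleOn X′ vs@(s ∷ _) = 3 ≤ length vs × Unique vs × Linked Adjacent (vs ∷ʳ s) ×
    (∀ x → (inj₁ x ∈ vs → x Subset.∈ X′) × (x Subset.∈ X′ → inj₁ x ∈ vs))

  isCycleOn? : ∀ X′ → Decidable (IsCycleOn X′)
  isCycleOn? X′ [] = no λ ()
  isCycleOn? X′ vs@(s ∷ _) = (3 ≤? length vs) ×-dec unique? _≟ᵛ_ vs ×-dec linked? adjacent? (vs ∷ʳ s) ×-dec
    Fin.all? λ x → ((inj₁ x ∈ᵛ? vs) →-dec (x Subset.∈? X′)) ×-dec ((x Subset.∈? X′) →-dec (inj₁ x ∈ᵛ? vs))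
    where
    _≟ᵛ_ = ≡-dec Fin._≟_ Fin._≟_
    open import Data.List.Membership.DecPropositional _≟ᵛ_ renaming (_∈?_ to _∈ᵛ?_)
    adjacent? : ∀ u v → Dec (Adjacent u v)
    adjacent? (inj₁ x) (inj₂ y) = x —? y
    adjacent? (inj₂ y) (inj₁ x) = x —? y
    adjacent? (inj₁ _) (inj₁ _) = no λ ()
    adjacent? (inj₂ _) (inj₂ _) = no λ ()

  -- Refuting that there is no cycle yields one, since only finitely many vertex
  -- lists need to be searched.
  search : ∀ N {P : Pred (List Vertex) 0ℓ} → Decidable P → Dec (∃[ vs ] length vs ≡ N × P vs)
  search zero P? = Dec.map′ (λ p → [] , refl , p) (λ { ([] , _ , p) → p }) (P? [])
  search (suc N) {P} P? = Dec.map′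
    [ (λ (x , vs , |vs| , p) → inj₁ x ∷ vs , cong suc |vs| , p) , (λ (y , vs , |vs| , p) → inj₂ y ∷ vs , cong suc |vs| , p) ]′
    (λ { (inj₁ x ∷ vs , |vs| , p) → inj₁ (x , vs , suc-injective |vs| , p)
       ; (inj₂ y ∷ vs , |vs| , p) → inj₂ (y , vs , suc-injective |vs| , p) })
    (Fin.any? (λ x → search N (λ vs → P? (inj₁ x ∷ vs))) ⊎-dec Fin.any? (λ y → search N (λ vs → P? (inj₂ y ∷ vs))))

  -- Induction on the number of X-vertices.

  module _ {δ} (n≤δ : n ≤ δ) (m≤ : m + 5 ≤ 3 * δ) (δ≤ : ∀ v → δ ≤ degree v)
    (robust : ∀ L → Unique L → 3 ≤ length L → Exits L × Fresh L) where

    unneighbourly : ∀ {k L} → Unique L → length L ≡ suc k → 2 ≤ k →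
      (∀ {u v S} → Unique S → Seg u v (L , S) → Apart S u v) →
      ∀ {x S} → Unique S → ¬ Near x (L , S)
    unneighbourly {k} {L} uL |L| 2≤k noHam uS N = let (exits , fresh) = robust L uL (≤-trans (s≤s 2≤k) (≤-reflexive (sym |L|))) in
      Step.no-near L uL k |L| 2≤k (≤-trans k<n n≤δ) m≤ δ≤ noHam exits fresh k uS N (m≤m+n k _)
      where
      k<n : suc k ≤ n
      k<n = ≤-trans (≤-reflexive (sym |L|)) (≤-trans (⊆-length uL λ {x} _ → ∈-allFin x)
        (≤-reflexive (length-tabulate id)))

    -- This is the double negation of a cycle on `L`. A cycle on the tail of `L` is a `Near` for its
    -- head, which `unneighbourly` refutes. For three vertices, two common neighbours of a pair give
    -- a 4-cycle that leaves out the third.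
    hamiltonian : ∀ k L → Unique L → length L ≡ suc k → 2 ≤ k →
      ¬ (∀ {u v S} → Unique S → Seg u v (L , S) → Apart S u v)
    hamiltonian 1 _ _ _ (s≤s ())
    hamiltonian 2 L@(a ∷ b ∷ c ∷ []) uL@((a≢b ∷ a≢c ∷ []) ∷ (b≢c ∷ []) ∷ _) refl 2≤2 noHam = base
      where
      exits : Exits L
      exits = proj₁ (robust L uL ≤-refl)
      pair : ∀ {y z : Y} → y ≢ z → Unique (y ∷ z ∷ [])
      pair y≢z = (y≢z ∷ []) ∷ [] ∷ []
      four-cycle : ∀ {x v w y z} → x ∷ v ∷ w ∷ [] ↭ L → v — y → w — y → v — z → w — z → y ≢ z → ⊥
      four-cycle {v = v} {w} {y} {z} p v—y w—y v—z w—z y≢z = unneighbourly uL refl 2≤2 noHam (pair (≢-sym y≢z))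
        (near (step v y v—y w—y (end w)) z v—z w—z (p , ↭-refl))
      base : ⊥
      -- Deleting c joins a and b by y. Deleting y joins a by z either to b, giving a 4-cycle, or to
      -- c; in the latter case deleting a joins b and c by t.
      base with exits (inj₁ c) (here refl) (there (here refl)) a≢b (λ { refl → a≢c refl }) (λ { refl → b≢c refl })
      ... | _ , _ , _ , _ , here refl , w≢a , _ = w≢a refl
      ... | _ , _ , _ , _ , there (there (here refl)) , _ , _ , c≢w = c≢w refl
      ... | y , _ , a—y , b—y , there (here refl) , _
        with exits (inj₂ y) (here refl) (there (here refl)) a≢b (λ ()) (λ ())
      ... | _ , _ , _ , _ , here refl , w≢a , _ = w≢a refl
      ... | z , _ , a—z , b—z , there (here refl) , _ , y≢z , _ =
        four-cycle (↭-sym (shift c (a ∷ b ∷ []) [])) a—y b—y a—z b—z (y≢z ∘ cong inj₂)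
      ... | z , _ , a—z , c—z , there (there (here refl)) , _ , y≢z , _
        with exits (inj₁ a) (there (here refl)) (there (there (here refl))) b≢c (λ { refl → a≢b refl }) (λ { refl → a≢c refl })
      ... | _ , _ , _ , _ , here refl , _ , _ , a≢w = a≢w refl
      ... | _ , _ , _ , _ , there (here refl) , w≢b , _ = w≢b refl
      ... | t , _ , b—t , c—t , there (there (here refl)) , _ with t Fin.≟ y | t Fin.≟ z
      ... | yes refl | _ = four-cycle (↭-sym (shift b (a ∷ []) (c ∷ []))) a—y c—t a—z c—z (y≢z ∘ cong inj₂)
      ... | no _ | yes refl = four-cycle (↭-sym (shift c (a ∷ b ∷ []) [])) a—y b—y a—z b—t (y≢z ∘ cong inj₂)
      -- With y, t and z distinct, z closes the path a, y, b, t, c to a 6-cycle.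
      ... | no t≢y | no t≢z = noHam (pair (≢-sym t≢y))
        (step a y a—y b—y (step b t b—t c—t (end c)) , ↭-refl , ↭-refl)
        (λ { (here z≡y) → y≢z (cong inj₂ (sym z≡y)) ; (there (here z≡t)) → t≢z (sym z≡t) }) a—z c—z
    hamiltonian (suc (suc (suc k))) (x ∷ L) (x∉ ∷ uL) |L| 2≤k noHam =
      hamiltonian (suc (suc k)) L uL (suc-injective |L|) (s≤s (s≤s z≤n)) λ {u} {v} {S} uS σ@(P , (xs↭ , ys↭)) {c} c∉ u—c v—c →
        unneighbourly (x∉ ∷ uL) |L| 2≤k noHam (All.¬Any⇒All¬ _ c∉ ∷ uS) (near P c u—c v—c (prep x xs↭ , prep c ys↭))

    superPancyclic : X-SuperPancyclic
    superPancyclic X′ 3≤ with length L in |L|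
      where L = elements X′
    ... | zero = contradiction (≤-trans 3≤ (≤-reflexive (trans (∣p∣≡length-elements X′) |L|))) λ ()
    -- A cycle alternates between the parts, so it has twice `suc k` vertices.
    ... | suc k with search (suc (suc k + k)) (isCycleOn? X′)
    ...   | yes (s ∷ r , _ , long , distinct , closed , meets) =
      record { start = s ; rest = r ; long = long ; distinct = distinct ; closed = closed } ,
      λ x → mk⇔ (proj₁ (meets x)) (proj₂ (meets x))
    ...   | no none = ⊥-elim (hamiltonian k L uL |L| 2≤k
      λ uS (P , (xs↭ , ys↭)) c∉ u—c v—c → none (to-cycle P xs↭ (Unique-resp-↭ (↭-sym ys↭) uS)
        (λ c∈ → c∉ (∈-resp-↭ ys↭ c∈)) u—c v—c))
      where
      L = elements X′
      uL : Unique L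
      uL = Unique.filter⁺ _ (Unique.allFin⁺ n)
      2≤k : 2 ≤ k
      2≤k = s≤s⁻¹ (≤-trans 3≤ (≤-reflexive (trans (∣p∣≡length-elements X′) |L|)))
      to-cycle : ∀ {u v c} (P : Path u v) → xsOf P ↭ L → Unique (ysOf P) → c ∉ ysOf P → u — c → v — c →
        ∃[ vs ] length vs ≡ suc (suc k + k) × IsCycleOn X′ vs
      to-cycle {c = c} P xs↭ uys c∉ u—c v—c = inj₂ c ∷ verts P , cong suc |verts| ,
        ≤-trans (s≤s (s≤s (≤-trans (s≤s z≤n) (≤-trans 2≤k (m≤m+n k k))))) (≤-reflexive (cong suc (sym |verts|))) ,
        All.¬Any⇒All¬ _ (c∉ ∘ ∈-ys P) ∷ unique-verts P (Unique-resp-↭ (↭-sym xs↭) uL) uys ,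
        linked-cycle P u—c v—c ,
        λ x → (λ { (there x∈) → proj₂ (∈-filter⁻ (Subset._∈? X′) {xs = allFin n} (∈-resp-↭ xs↭ (∈-xs P x∈))) }) ,
          λ x∈ → there (xs-∈ P (∈-resp-↭ (↭-sym xs↭) (∈-filter⁺ (Subset._∈? X′) (∈-allFin x) x∈)))
        where
        |xs| : length (xsOf P) ≡ suc k
        |xs| = trans (↭-length xs↭) |L|
        |verts| : length (verts P) ≡ suc k + k
        |verts| = trans (length-verts P) (cong₂ _+_ |xs| (suc-injective (trans (sym (length-bag P)) |xs|)))

  -- Exits and fresh vertices from 2-connected subgraphs.

  module _ {L : List X} (uL : Unique L) (3≤ : 3 ≤ length L) where

    private
      A : Subset n
      A = Vec.tabulate (λ x → does (x ∈ˣ? L))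

      |L|≤∣A∣ : length L ≤ ∣ A ∣
      |L|≤∣A∣ = ≤-trans (⊆-length uL λ {x} x∈ → ∈-filter⁺ (_∈ˣ? L) (∈-allFin x) x∈)
        (≤-reflexive (sym (∣tabulate∣ (_∈ˣ? L) id)))

      ∈A : ∀ {x} → x ∈ L → x Subset.∈ A
      ∈A {x} x∈ = Vec.lookup⇒[]= x A (trans (Vec.lookup∘tabulate _ x) (dec-true (x ∈ˣ? L) x∈))

      A∈ : ∀ {x} → x Subset.∈ A → x ∈ L
      A∈ {x} x∈ with x ∈ˣ? L | trans (sym (Vec.lookup∘tabulate (λ x → does (x ∈ˣ? L)) x)) (Vec.[]=⇒lookup x∈)
      ... | yes x∈L | _ = x∈L
      ... | no _ | ()

    module _ {B : Subset m} (∣A∣≤∣B∣ : ∣ B ∣ ≥ ∣ A ∣) (2-connected : 2-Connected (graph [ A ⊔ᵥ B ])) where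

      private
        V : Vertex → Set
        V = A ⊔ᵥ B

        Edge : Vertex → Vertex → Vertex → Set
        Edge r u v = Adjacent u v × V v × r ≢ v

        -- If r lies outside the subgraph, connectedness without deletion suffices, as its walks
        -- cannot meet r.
        walk : ∀ r {u v} → V u → V v → r ≢ u → r ≢ v → Star (Edge r) u v
        walk r {u} {v} u∈ v∈ r≢u r≢v with V? r
          where
          V? : ∀ r → Dec (V r)
          V? (inj₁ x) = x Subset.∈? A
          V? (inj₂ y) = y Subset.∈? B
        ... | yes r∈ = Star.map (λ { ((e , _ , v∈) , _ , r≢v) → e , v∈ , r≢v })
              (proj₂ (proj₂ (proj₂ 2-connected) r (tt , r∈)) ((tt , u∈) , r≢u) ((tt , v∈) , r≢v))
        ... | no r∉ = Star.map (λ { (e , _ , v∈) → e , v∈ , λ { refl → r∉ v∈ } })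
              (proj₂ (proj₁ (proj₂ 2-connected)) (tt , u∈) (tt , v∈))

      -- On a walk from x to t avoiding r, read two edges at a time, the first pair of edges that
      -- does not return to x is the exit.
      exits-of-2-connected : Exits L
      exits-of-2-connected r {x} {t} x∈ t∈ x≢t r≢x r≢t = leave (walk r {inj₁ x} {inj₁ t} (∈A x∈) (∈A t∈) r≢x r≢t)
        where
        leave : Star (Edge r) (inj₁ x) (inj₁ t) →
          ∃[ y ] ∃[ w ] x — y × w — y × w ∈ L × w ≢ x × r ≢ inj₂ y × r ≢ inj₁ w
        leave ε = contradiction refl x≢t
        leave (_◅_ {j = inj₂ y} (x—y , _ , r≢y) (_◅_ {j = inj₁ w} (w—y , w∈ , r≢w) rest)) with w Fin.≟ x
        ... | yes refl = leave rest
        ... | no w≢x = y , w , x—y , w—y , A∈ w∈ , w≢x , r≢y , r≢w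

      -- `B` is larger than `S`, so it has some b outside `S`. After a deletion there is still a
      -- walk from b into `L`, and its first edge gives a neighbour.
      fresh-of-2-connected : Fresh L
      fresh-of-2-connected S |S|< with All.all? (_∈? S) (elements B)
      ... | yes all = contradiction (≤-trans |S|< (≤-trans |L|≤∣A∣ (≤-trans ∣A∣≤∣B∣
            (≤-trans (≤-reflexive (∣p∣≡length-elements B))
              (⊆-length (Unique.filter⁺ _ (Unique.allFin⁺ m)) (All.lookup all)))))) 1+n≰n
      ... | no ¬all with find (All.¬All⇒Any¬ (_∈? S) _ ¬all)
      ...   | b , b∈ , b∉S = two-neighbours L uL 3≤ id
        where
        neighbour : ∀ r {t} → t ∈ L → r ≢ inj₁ t → r ≢ inj₂ b → ∃[ w ] w ∈ L × w — b × r ≢ inj₁ w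
        neighbour r {t} t∈ r≢t r≢b
          with walk r {inj₂ b} {inj₁ t} (proj₂ (∈-filter⁻ (Subset._∈? B) {xs = allFin m} b∈)) (∈A t∈) r≢b r≢t
        ... | _◅_ {j = inj₁ w} (w—b , w∈ , r≢w) _ = w , A∈ w∈ , w—b , r≢w
        two-neighbours : ∀ L′ → Unique L′ → 3 ≤ length L′ → L′ ⊆ L →
          ∃[ b ] ∃[ v ] ∃[ w ] b ∉ S × v ∈ L × w ∈ L × v ≢ w × v — b × w — b
        two-neighbours (_ ∷ []) _ (s≤s ()) _
        -- Deleting a gives v different from a, so a is available as target when v is deleted.
        two-neighbours (a ∷ a′ ∷ _) ((a≢a′ ∷ _) ∷ _) _ ⊆L
          with neighbour (inj₁ a) (⊆L (there (here refl))) (a≢a′ ∘ inj₁-injective) (λ ())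
        ... | v , v∈ , v—b , a≢v with neighbour (inj₁ v) (⊆L (here refl)) (≢-sym a≢v) (λ ())
        ...   | w , w∈ , w—b , v≢w = b , v , w , b∉S , v∈ , w∈ , v≢w ∘ cong inj₁ , v—b , w—b

    exits×fresh : (∀ (A : Subset n) → ∣ A ∣ ≥ 3 →
      ∃[ B ] ∣ B ∣ ≥ ∣ A ∣ × 2-Connected (graph [ A ⊔ᵥ B ])) → Exits L × Fresh L
    exits×fresh hyp = let (B , ∣B∣≥ , 2-connected) = hyp A (≤-trans 3≤ |L|≤∣A∣) in
      exits-of-2-connected {B} ∣B∣≥ 2-connected , fresh-of-2-connected {B} ∣B∣≥ 2-connected

theorem8 : ∀ (n m δ : ℕ) → n ≥ 2 → δ ≥ n → m ≤ 3 * δ ∸ 5 →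
    (G : Bigraph n m) → let open Bigraph G in
    (∀ (x : Fin n) → degree x ≥ δ) →
    (∀ (A : Subset n) → ∣ A ∣ ≥ 3 →
    ∃[ B ] ∣ B ∣ ≥ ∣ A ∣ × 2-Connected (graph [ A ⊔ᵥ B ])) →
    X-SuperPancyclic
theorem8 n m δ n≥2 δ≥n m≤ G δ≤ hyp = superPancyclic G δ≥n m+5≤3δ δ≤ λ L uL 3≤ → exits×fresh G uL 3≤ hyp
  where
  -- The truncated subtraction is exact, because `δ ≥ n ≥ 2` gives `6 ≤ 3 * δ`.
  m+5≤3δ : m + 5 ≤ 3 * δ
  m+5≤3δ = ≤-trans (+-monoˡ-≤ 5 m≤) (≤-reflexive (m∸n+n≡m
    (≤-trans (n≤1+n 5) (*-monoʳ-≤ 3 (≤-trans n≥2 δ≥n)))))
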